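{- Fix $r\ge1$ and let $P=\sum_{k\ge0}p_k\bar z^{\,k}$, where $p_k=\sum_{n\ge0}p_n^{(k)}x^n$ and $p_n^{(k)}$ is the number of two-stack-sortable $k$-tuple $r$-permutations of $[n]$ with components allowed to be empty. Let $y$ be the formal power series in $x$ with zero constant term determined by $x=\frac{y}{(1+y)^{2r+1}}$, let $t=y(1+y)\frac{\bar z}{1-\bar z}$ and $c(t)=\frac{1-\sqrt{1-4t}}{2t}$. Then $$P=\left(1+\frac{t}{y(1+y)}\right)\frac{c(t)(1+y)^{r+1}}{(1+y\,c(t))^{r+1}}.$$
   Context: An $r$-permutation of a finite set $A$ of positive integers is a word in which each element of $A$ appears exactly $r$ times such that whenever $i<j<k$ and $a_i=a_k$ we have $a_j\le a_i$. A $k$-tuple $r$-permutation of $[n]$ is a tuple $(\alpha_1,\dots,\alpha_k)$ of words whose concatenation is an $r$-permutation of $[n]$ and in which every letter appears in only one $\alpha_i$. Stack sorting $S$: on words with distinct letters, $S(\emptyset)=\emptyset$ and $S(\pi_lm\pi_r)=S(\pi_l)S(\pi_r)m$ with $m$ the largest letter; on a nonempty $r$-permutation with largest letter $m$, written $\alpha_1m\alpha_2m\cdots m\alpha_{r+1}$, $S(\pi)=S(\alpha_1)\cdots S(\alpha_{r+1})m$; $S(\emptyset)=\emptyset$. The tuple is two-stack-sortable if $S(S(\alpha_1)\cdots S(\alpha_k))=12\cdots n$. -}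

module Defs where

open import Data.Nat as ℕ using (ℕ; zero; suc; _∸_; _<ᵇ_; _≤ᵇ_; _≡ᵇ_)
open import Data.Bool using (Bool; true; false; _∧_; _∨_; not; if_then_else_)
open import Data.List using (List; []; _∷_; _++_; map; concat; concatMap; length; filter; foldr; reverse)
open import Data.Integer using (+_)
open import Data.Rational as Q using (ℚ; 0ℚ; 1ℚ)
open import Relation.Binary.PropositionalEquality using (_≡_)

range1 : ℕ → List ℕ
range1 zero = []
range1 (suc n) = range1 n ++ (suc n ∷ [])

indices : ℕ → List ℕ
indices zero = []
indices (suc n) = indices n ++ (n ∷ [])

allB : {A : Set} → (A → Bool) → List A → Bool
allB p [] = true
allB p (a ∷ as) = p a ∧ allB p as

anyB : {A : Set} → (A → Bool) → List A → Bool
anyB p [] = false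
anyB p (a ∷ as) = p a ∨ anyB p as

countB : {A : Set} → (A → Bool) → List A → ℕ
countB p [] = 0
countB p (a ∷ as) = if p a then suc (countB p as) else countB p as

occ : ℕ → List ℕ → ℕ
occ a w = countB (λ b → a ≡ᵇ b) w

-- i-th letter (0-based); default 0 out of range (never used out of range)
nth : List ℕ → ℕ → ℕ
nth [] _ = 0
nth (a ∷ w) zero = a
nth (a ∷ w) (suc i) = nth w i

isRPerm : ℕ → List ℕ → List ℕ → Bool
isRPerm r A w =
  allB (λ b → anyB (λ a → a ≡ᵇ b) A) w
  ∧ allB (λ a → occ a w ≡ᵇ r) A
  ∧ allB (λ i → allB (λ j → allB (λ k →
        not ((i <ᵇ j) ∧ (j <ᵇ k) ∧ (nth w i ≡ᵇ nth w k))
        ∨ (nth w j ≤ᵇ nth w i))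
      (indices (length w))) (indices (length w))) (indices (length w))

maxL : List ℕ → ℕ
maxL [] = 0
maxL (a ∷ w) = ℕ._⊔_ a (maxL w)

splitOn : ℕ → List ℕ → List (List ℕ)
splitOn m [] = [] ∷ []
splitOn m (a ∷ w) with m ≡ᵇ a | splitOn m w
... | true  | segs = [] ∷ segs
... | false | [] = (a ∷ []) ∷ []
... | false | (s ∷ segs) = (a ∷ s) ∷ segs

-- S with fuel (recursion on length); fuel = length + 1 always suffices,
-- since every segment is strictly shorter than the word.
-- S(∅) = ∅ ; S(α₁ m α₂ m ⋯ m α_{s+1}) = S(α₁)⋯S(α_{s+1}) m, m the largest letter.
-- On words with distinct letters this is S(π_l m π_r) = S(π_l) S(π_r) m.
stackF : ℕ → List ℕ → List ℕ
stackF zero w = []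
stackF (suc f) [] = []
stackF (suc f) (a ∷ w) =
  concat (map (stackF f) (splitOn (maxL (a ∷ w)) (a ∷ w))) ++ (maxL (a ∷ w) ∷ [])

S : List ℕ → List ℕ
S w = stackF (suc (length w)) w

isTupleRPerm : ℕ → ℕ → List (List ℕ) → Bool
isTupleRPerm r n αs =
  isRPerm r (range1 n) (concat αs)
  ∧ allB (λ a → countB (λ α → anyB (λ b → a ≡ᵇ b) α) αs ≤ᵇ 1) (range1 n)

eqList : List ℕ → List ℕ → Bool
eqList [] [] = true
eqList (a ∷ u) (b ∷ v) = (a ≡ᵇ b) ∧ eqList u v
eqList _ _ = false

twoStackSortable : ℕ → List (List ℕ) → Bool
twoStackSortable n αs = eqList (S (concat (map S αs))) (range1 n)

words : ℕ → ℕ → List (List ℕ)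
words n zero = [] ∷ []
words n (suc m) = concatMap (λ a → map (a ∷_) (words n m)) (range1 n)

-- all k-tuples (lists of length k) of words over [n] of total length L
-- (components may be empty); each tuple is listed exactly once
tuples : ℕ → ℕ → ℕ → List (List (List ℕ))
tuples n zero zero = [] ∷ []
tuples n zero (suc L) = []
tuples n (suc k) L =
  concatMap (λ l → concatMap (λ α → map (α ∷_) (tuples n k (L ∸ l))) (words n l))
            (indices (suc L))

-- p_n^{(k)}: number of two-stack-sortable k-tuple r-permutations of [n]
-- (an r-permutation of [n] has length r·n)
p : ℕ → ℕ → ℕ → ℕ
p r n k = countB (λ αs → isTupleRPerm r n αs ∧ twoStackSortable n αs)
                 (tuples n k (ℕ._*_ r n))

-- Formal power series in x and z̄ over ℚ:  F n k = [x^n z̄^k] F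

Series : Set
Series = ℕ → ℕ → ℚ

ℕ→ℚ : ℕ → ℚ
ℕ→ℚ m = + m Q./ 1

sumTo : ℕ → (ℕ → ℚ) → ℚ
sumTo zero f = f 0
sumTo (suc n) f = sumTo n f Q.+ f (suc n)

_≗ˢ_ : Series → Series → Set
F ≗ˢ G = ∀ n k → F n k ≡ G n k
infix 4 _≗ˢ_

_⊕_ : Series → Series → Series
(F ⊕ G) n k = F n k Q.+ G n k
infixl 6 _⊕_

_⊖_ : Series → Series → Series
(F ⊖ G) n k = F n k Q.- G n k
infixl 6 _⊖_

_⊗_ : Series → Series → Series
(F ⊗ G) n k = sumTo n (λ i → sumTo k (λ j → F i j Q.* G (n ∸ i) (k ∸ j)))
infixl 7 _⊗_

_·ˢ_ : ℚ → Series → Series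
(c ·ˢ F) n k = c Q.* F n k
infixl 7 _·ˢ_

mono : ℕ → ℕ → Series
mono a b n k = if (a ≡ᵇ n) ∧ (b ≡ᵇ k) then 1ℚ else 0ℚ

𝟙 : Series
𝟙 = mono 0 0

X : Series
X = mono 1 0

Z : Series
Z = mono 0 1

_^ˢ_ : Series → ℕ → Series
F ^ˢ zero = 𝟙
F ^ˢ suc e = F ⊗ (F ^ˢ e)
infixr 8 _^ˢ_

Pgf : ℕ → Series
Pgf r n k = ℕ→ℚ (p r n k)

module Submission where

-- Decompose a valid tuple at its largest letter N: the component containing N is β₁ N β₂ N ⋯ N β_{r+1}, and two-stack
-- sortability splits into that of the (i+r)-tuple formed by the i-1 components before it and the βⱼ, on the m smallest
-- letters, and that of the (k-i)-tuple of the remaining components, on the other letters.  Hence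
-- p⁽ᵏ⁾_{n+1} = Σ_{i,m} p⁽ⁱ⁺ʳ⁾_m p⁽ᵏ⁻ⁱ⁾_{n-m}, a recurrence on n that determines P.
-- The closed form Q satisfies it by the kernel identity xQ + z̄ʳ/((1-z̄)Q) = z̄ʳ(aʳ⁺¹/c + a′ʳ⁺¹/c′)/(1+y)ʳ⁺¹, where
-- c′ = c/(c-1) is the second root of c = 1 + t c², a = 1 + yc and a′ = 1 + yc′.  Because z̄ a a′ = 1 and z̄(a + a′) has
-- degree one in z̄, the right-hand side is a polynomial of degree at most r in z̄; comparing the coefficients of z̄^{r+k}
-- for k > 0 is the recurrence.

-- The variable z̄ is catalytic. Summed over n and k, the recurrence reads P = 1/(1-z̄) + xP(P -
-- R)/z̄ʳ, where R collects the terms of P of degree at most r in z̄, which are r + 1 unknown series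
-- in x. Division by P turns this into xP + z̄ʳ/((1-z̄)P) = z̄ʳ + xR. Hence a candidate is checked
-- by bounding the degree of the left side, and R never has to be found; the bound says nothing
-- about the coefficient of z̄ʳ, which is settled by the value 1 of 1/((1-z̄)Q) at z̄ = 0. The
-- conjugate root c′ = 1/(tc) has a pole at z̄ = 0, so the algebra works with z̄a′ = 1/a and 1/c′ =
-- tc, which are power series. On the combinatorial side, the first pass of S puts N last in its
-- component, so the second pass meets a word uNv and returns S(u)S(v)N. This is increasing without
-- gaps exactly when S(u) and S(v) are a lower and an upper interval. The βⱼ may serve as separate
-- components because a letter a < N in two of them would give the forbidden pattern a N a.

open import Defs
open import Algebra using (CommutativeRing; IsCommutativeRing)
import Algebra.Properties.CommutativeSemigroup as CommutativeSemigroupProperties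
import Algebra.Properties.Group as GroupProperties
import Algebra.Properties.Semiring.Exp as Exp
import Algebra.Solver.Ring.NaturalCoefficients.Default as NatSolver
open import Data.Bool using (Bool; true; false; if_then_else_; T; T?; _∧_; _∨_; not)
open import Data.Empty using (⊥; ⊥-elim)
import Data.Integer as ℤ
import Data.Integer.Properties as ℤ
open import Data.List using (List; []; _∷_; _++_; map; concat; concatMap; length; [_]; replicate; take; drop; filter)
import Data.List.Properties as List
open import Data.List.Membership.Propositional using (_∈_; _∉_; find; lose)
open import Data.List.Membership.Propositional.Properties
  using (∈-++⁺ˡ; ∈-++⁺ʳ; ∈-++⁻; ∈-map⁺; ∈-map⁻; ∈-filter⁺; ∈-filter⁻; ∈-concatMap⁺; ∈-concatMap⁻; ∈-∃++; ∈-concat⁻′)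
open import Data.List.Membership.Propositional.Properties.WithK using (unique∧set⇒bag)
open import Data.List.Relation.Binary.BagAndSetEquality using (∼bag⇒↭)
open import Data.List.Relation.Binary.Permutation.Propositional.Properties using (↭-length)
open import Data.List.Relation.Binary.Sublist.Propositional
  using (_⊆_; []; _∷_; _∷ʳ_; ⊆-refl; ⊆-trans; to∈; from∈; lookup; minimum)
open import Data.List.Relation.Binary.Sublist.Propositional.Properties using (++⁺; ++⁺ˡ; ++⁺ʳ)
open import Data.List.Relation.Unary.All as All using (All; []; _∷_)
open import Data.List.Relation.Unary.AllPairs using ([]; _∷_)
open import Data.List.Relation.Unary.Any using (here; there)
open import Data.List.Relation.Unary.Unique.Propositional using (Unique)
import Data.List.Relation.Unary.Unique.Propositional.Properties as Unique
open import Data.Nat as ℕ using (ℕ; zero; suc; _∸_; _≤_; _<_; _≡ᵇ_; _≤ᵇ_; _<ᵇ_; z≤n; s≤s)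
open import Data.Nat.Induction using (<-rec)
import Data.Nat.Properties as ℕ
open import Data.Product using (∃-syntax; _×_; _,_; proj₁; proj₂)
open import Data.Rational as ℚ using (ℚ; 0ℚ; 1ℚ; toℚᵘ)
import Data.Rational.Properties as ℚ
open import Data.Rational.Unnormalised as ℚᵘ using (mkℚᵘ; *≡*)
import Data.Rational.Unnormalised.Properties as ℚᵘ
open import Data.Sum using (_⊎_; inj₁; inj₂; [_,_]′)
open import Data.Unit using (⊤; tt)
open import Function using (_∘_; id; mk⇔)
import Relation.Binary.PropositionalEquality as ≡
import Relation.Binary.Reasoning.Setoid as SetoidReasoning
open import Relation.Nullary using (yes; no; contradiction)

-- Formal power series

module FormalPowerSeries {c ℓ} (R : CommutativeRing c ℓ) where
  open CommutativeRing R hiding (zero)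
  open SetoidReasoning setoid
  open CommutativeSemigroupProperties +-commutativeSemigroup using (interchange; x∙yz≈y∙xz)

  PowerSeries : Set c
  PowerSeries = ℕ → Carrier

  infix 4 _≋_
  _≋_ : PowerSeries → PowerSeries → Set ℓ
  F ≋ G = ∀ n → F n ≈ G n

  ∑ : ℕ → (ℕ → Carrier) → Carrier
  ∑ zero f = f 0
  ∑ (suc n) f = ∑ n f + f (suc n)

  ∑-cong : ∀ n {f g} → (∀ i → f i ≈ g i) → ∑ n f ≈ ∑ n g
  ∑-cong zero e = e 0
  ∑-cong (suc n) e = +-cong (∑-cong n e) (e (suc n))

  ∑-+ : ∀ n f g → ∑ n (λ i → f i + g i) ≈ ∑ n f + ∑ n g
  ∑-+ zero f g = refl
  ∑-+ (suc n) f g = trans (+-congʳ (∑-+ n f g)) (interchange _ _ _ _)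

  ∑-*ˡ : ∀ n a f → ∑ n (λ i → a * f i) ≈ a * ∑ n f
  ∑-*ˡ zero a f = refl
  ∑-*ˡ (suc n) a f = trans (+-congʳ (∑-*ˡ n a f)) (sym (distribˡ _ _ _))

  ∑-head : ∀ n f → ∑ (suc n) f ≈ f 0 + ∑ n (λ i → f (suc i))
  ∑-head zero f = refl
  ∑-head (suc n) f = trans (+-congʳ (∑-head n f)) (+-assoc _ _ _)

  tail : PowerSeries → PowerSeries
  tail F n = F (suc n)

  infixl 7 _⋆_
  infixl 6 _⊞_

  _⊞_ : PowerSeries → PowerSeries → PowerSeries
  (F ⊞ G) n = F n + G n

  ⊟_ : PowerSeries → PowerSeries
  (⊟ F) n = - F n

  _⋆_ : PowerSeries → PowerSeries → PowerSeries
  (F ⋆ G) n = ∑ n (λ i → F i * G (n ∸ i))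

  𝟘 : PowerSeries
  𝟘 n = 0#

  one : PowerSeries
  one zero = 1#
  one (suc n) = 0#

  -- Separating the constant term from `tail F` lets associativity and commutativity be proved by
  -- induction on the coefficient, with no reindexing of double sums.
  ⋆-suc : ∀ F G n → (F ⋆ G) (suc n) ≈ F 0 * G (suc n) + (tail F ⋆ G) n
  ⋆-suc F G n = ∑-head n _

  ⋆-cong : ∀ {F F′ G G′} → F ≋ F′ → G ≋ G′ → F ⋆ G ≋ F′ ⋆ G′
  ⋆-cong p q n = ∑-cong n (λ i → *-cong (p i) (q (n ∸ i)))

  ⋆-distribʳ : ∀ H F G → (F ⊞ G) ⋆ H ≋ F ⋆ H ⊞ G ⋆ H
  ⋆-distribʳ H F G n = trans (∑-cong n (λ i → distribʳ _ _ _)) (∑-+ n _ _)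

  ⋆-scale : ∀ a F G → (λ n → a * F n) ⋆ G ≋ (λ n → a * (F ⋆ G) n)
  ⋆-scale a F G n = trans (∑-cong n (λ i → *-assoc _ _ _)) (∑-*ˡ n a _)

  ⋆-assoc : ∀ F G H → (F ⋆ G) ⋆ H ≋ F ⋆ (G ⋆ H)
  ⋆-assoc F G H zero = *-assoc _ _ _
  ⋆-assoc F G H (suc n) = begin
    ((F ⋆ G) ⋆ H) (suc n)
      ≈⟨ ⋆-suc (F ⋆ G) H n ⟩
    F 0 * G 0 * H (suc n) + (tail (F ⋆ G) ⋆ H) n
      ≈⟨ +-cong (*-assoc _ _ _) (⋆-cong {G = H} (⋆-suc F G) (λ _ → refl) n) ⟩
    F 0 * (G 0 * H (suc n)) + (((λ m → F 0 * tail G m) ⊞ tail F ⋆ G) ⋆ H) n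
      ≈⟨ +-congˡ (⋆-distribʳ H _ _ n) ⟩
    F 0 * (G 0 * H (suc n)) + (((λ m → F 0 * tail G m) ⋆ H) n + ((tail F ⋆ G) ⋆ H) n)
      ≈⟨ +-congˡ (+-cong (⋆-scale (F 0) (tail G) H n) (⋆-assoc (tail F) G H n)) ⟩
    F 0 * (G 0 * H (suc n)) + (F 0 * (tail G ⋆ H) n + (tail F ⋆ (G ⋆ H)) n)
      ≈⟨ +-assoc _ _ _ ⟨
    (F 0 * (G 0 * H (suc n)) + F 0 * (tail G ⋆ H) n) + (tail F ⋆ (G ⋆ H)) n
      ≈⟨ +-congʳ (distribˡ _ _ _) ⟨
    F 0 * (G 0 * H (suc n) + (tail G ⋆ H) n) + (tail F ⋆ (G ⋆ H)) n
      ≈⟨ +-congʳ (*-congˡ (⋆-suc G H n)) ⟨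
    F 0 * (G ⋆ H) (suc n) + (tail F ⋆ (G ⋆ H)) n
      ≈⟨ ⋆-suc F (G ⋆ H) n ⟨
    (F ⋆ (G ⋆ H)) (suc n) ∎

  -- Peeling both factors uses commutativity at coefficients n + 1 and n, so 0 and 1 are the base
  -- cases.
  ⋆-comm : ∀ F G → F ⋆ G ≋ G ⋆ F
  ⋆-comm F G zero = *-comm _ _
  ⋆-comm F G (suc zero) = trans (+-comm _ _) (+-cong (*-comm _ _) (*-comm _ _))
  ⋆-comm F G (suc (suc n)) = begin
    (F ⋆ G) (suc (suc n))
      ≈⟨ ⋆-suc F G (suc n) ⟩
    F 0 * G (suc (suc n)) + (tail F ⋆ G) (suc n)
      ≈⟨ +-congˡ (trans (⋆-comm (tail F) G (suc n)) (⋆-suc G (tail F) n)) ⟩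
    F 0 * G (suc (suc n)) + (G 0 * F (suc (suc n)) + (tail G ⋆ tail F) n)
      ≈⟨ x∙yz≈y∙xz _ _ _ ⟩
    G 0 * F (suc (suc n)) + (F 0 * G (suc (suc n)) + (tail G ⋆ tail F) n)
      ≈⟨ +-congˡ (+-congˡ (⋆-comm (tail G) (tail F) n)) ⟩
    G 0 * F (suc (suc n)) + (F 0 * G (suc (suc n)) + (tail F ⋆ tail G) n)
      ≈⟨ +-congˡ (trans (⋆-comm (tail G) F (suc n)) (⋆-suc F (tail G) n)) ⟨
    G 0 * F (suc (suc n)) + (tail G ⋆ F) (suc n)
      ≈⟨ ⋆-suc G F (suc n) ⟨
    (G ⋆ F) (suc (suc n)) ∎

  ∑-zero : ∀ n {f} → (∀ i → f i ≈ 0#) → ∑ n f ≈ 0#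
  ∑-zero zero e = e 0
  ∑-zero (suc n) e = trans (+-cong (∑-zero n e) (e (suc n))) (+-identityʳ _)

  ⋆-identityˡ : ∀ F → one ⋆ F ≋ F
  ⋆-identityˡ F zero = *-identityˡ _
  ⋆-identityˡ F (suc n) = begin
    (one ⋆ F) (suc n)             ≈⟨ ⋆-suc one F n ⟩
    1# * F (suc n) + (tail one ⋆ F) n  ≈⟨ +-cong (*-identityˡ _) (∑-zero n (λ i → zeroˡ _)) ⟩
    F (suc n) + 0#                     ≈⟨ +-identityʳ _ ⟩
    F (suc n) ∎

  powerSeries-isCommutativeRing : IsCommutativeRing _≋_ _⊞_ _⋆_ ⊟_ 𝟘 one
  powerSeries-isCommutativeRing = record
    { isRing = record
      { +-isAbelianGroup = record
        { isGroup = record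
          { isMonoid = record
            { isSemigroup = record
              { isMagma = record
                { isEquivalence = record
                  { refl = λ _ → refl
                  ; sym = λ e n → sym (e n)
                  ; trans = λ e e′ n → trans (e n) (e′ n)
                  }
                ; ∙-cong = λ e e′ n → +-cong (e n) (e′ n)
                }
              ; assoc = λ F G H n → +-assoc _ _ _
              }
            ; identity = (λ F n → +-identityˡ _) , (λ F n → +-identityʳ _)
            }
          ; inverse = (λ F n → -‿inverseˡ _) , (λ F n → -‿inverseʳ _)
          ; ⁻¹-cong = λ e n → -‿cong (e n)
          }
        ; comm = λ F G n → +-comm _ _
        }
      ; *-cong = λ {F} {F′} {G} {G′} → ⋆-cong {F} {F′} {G} {G′}
      ; *-assoc = ⋆-assoc
      ; *-identity = ⋆-identityˡ , λ F n → trans (⋆-comm F one n) (⋆-identityˡ F n)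
      ; distrib = (λ H F G n → trans (⋆-comm H (F ⊞ G) n)
                     (trans (⋆-distribʳ H F G n) (+-cong (⋆-comm F H n) (⋆-comm G H n))))
                , ⋆-distribʳ
      }
    ; *-comm = ⋆-comm
    }

  powerSeriesRing : CommutativeRing c ℓ
  powerSeriesRing = record { isCommutativeRing = powerSeries-isCommutativeRing }

-- The algebraic system of the closed form

module Identities {ℓ₁ ℓ₂} (R : CommutativeRing ℓ₁ ℓ₂) where
  open CommutativeRing R hiding (zero)
  open NatSolver commutativeSemiring using (solve; _:=_; _:+_; _:*_; con)
  open GroupProperties +-group using (∙-cancelʳ)
  open Exp semiring using (_^_; ^-homo-*)
  open SetoidReasoning setoid

  -- Used with L - T = P - Q, so that the identity left to the semiring solver contains no subtraction.
  lincomb : ∀ {L T P Q} → P ≈ Q → L + Q ≈ T + P → L ≈ T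
  lincomb {L} {T} {P} {Q} p e = ∙-cancelʳ Q L T (trans e (+-congˡ p))

  unit-cancel : ∀ i s {x y} → i * s ≈ 1# → s * x ≈ s * y → x ≈ y
  unit-cancel i s {x} {y} is e = begin
    x            ≈⟨ *-identityˡ x ⟨
    1# * x       ≈⟨ *-congʳ is ⟨
    i * s * x    ≈⟨ *-assoc _ _ _ ⟩
    i * (s * x)  ≈⟨ *-congˡ e ⟩
    i * (s * y)  ≈⟨ *-assoc _ _ _ ⟨
    i * s * y    ≈⟨ *-congʳ is ⟩
    1# * y       ≈⟨ *-identityˡ y ⟩
    y            ∎

  ^-* : ∀ x y n → (x * y) ^ n ≈ x ^ n * y ^ n
  ^-* x y zero = sym (*-identityˡ _)
  ^-* x y (suc n) = trans (*-congˡ (^-* x y n))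
    (solve 4 (λ x y X Y → x :* y :* (X :* Y) := x :* X :* (y :* Y)) refl x y (x ^ n) (y ^ n))

  1^ : ∀ n → 1# ^ n ≈ 1#
  1^ zero = refl
  1^ (suc n) = trans (*-identityˡ _) (1^ n)

  ^-inverse : ∀ {x y} n → x * y ≈ 1# → x ^ n * y ^ n ≈ 1#
  ^-inverse {x} {y} n e = trans (sym (^-* x y n)) (trans (pow-cong n e) (1^ n))
    where
    pow-cong : ∀ {x y} n → x ≈ y → x ^ n ≈ y ^ n
    pow-cong zero e = refl
    pow-cong (suc n) e = *-cong e (pow-cong n e)

  -- Reciprocals enter as elements with equations: v = 1/(1-z), b = 1/a with a = 1 + yc, and u =
  -- 1/c, which by the quadratic equation of c is 1 - tc.
  module Roots (y z v t c b u : Carrier)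
    (hv : v ≈ 1# + z * v)
    (ht : t ≈ y * (1# + y) * (z * v))
    (hc : c ≈ 1# + t * (c * c))
    (hb : b * (1# + y * c) ≈ 1#)
    (hu : u + t * c ≈ 1#)
    where

    uc : u * c ≈ 1#
    uc = lincomb (+-cong (*-congʳ {c} hu) hc)
      (solve 3 (λ u c t → u :* c :+ (con 1 :* c :+ (con 1 :+ t :* (c :* c)))
                       := con 1 :+ ((u :+ t :* c) :* c :+ c)) refl u c t)

    α : Carrier
    α = z * (1# + y * c)

    αb : α * b ≈ z
    αb = lincomb (*-congˡ {z} hb)
      (solve 4 (λ y z c b → z :* (con 1 :+ y :* c) :* b :+ z :* con 1
                         := z :+ z :* (b :* (con 1 :+ y :* c))) refl y z c b)

    ht′ : t ≈ t * z + y * (1# + y) * z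
    ht′ = lincomb (+-cong (+-cong ht (*-congˡ {z} (sym ht))) (*-congˡ {y * (1# + y) * z} hv))
      (solve 4 (λ y z v t → let T = y :* (con 1 :+ y) :* (z :* v); B = y :* (con 1 :+ y) :* z in
          t :+ ((T :+ z :* t) :+ B :* (con 1 :+ z :* v)) := (t :* z :+ B) :+ ((t :+ z :* T) :+ B :* v)) refl y z v t)

    -- The roots c and c′ have sum 1/t, so z(a + a′) = 2z + zy/t = 2z + (1-z)/(1+y), which is linear
    -- in z. Multiplication by a removes b and leaves a consequence of the equations of t and c.
    α+b : (1# + y) * (α + b) + z ≈ (z + z) * (1# + y) + 1#
    α+b = unit-cancel b (1# + y * c) hb (lincomb
      (+-cong (+-cong (*-congˡ {1# + y} hb) (*-congˡ {y * (c * c)} (sym ht′)))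
              (+-cong (*-congˡ {y} (sym hc)) (*-congˡ {y * z} hc)))
      (solve 5 (λ y z t c b →
         let s = con 1 :+ y; a = con 1 :+ y :* c; q = y :* (c :* c)
             T = t :* z :+ y :* s :* z; C = con 1 :+ t :* (c :* c) in
         a :* (s :* (z :* a :+ b) :+ z) :+ ((s :* con 1 :+ q :* t) :+ (y :* c :+ y :* z :* C))
         := a :* ((z :+ z) :* s :+ con 1) :+ ((s :* (b :* a) :+ q :* T) :+ (y :* C :+ y :* z :* c)))
         refl y z t c b))

    -- These are a/c and a′/c′. Since 1/c′ = tc and t = y(1+y)zv, the second is za′ · y(1+y)cv, and
    -- za′ = b is a power series although a′ has a pole at z = 0.
    e f : Carrier
    e = (1# + y * c) * u
    f = b * (y * (1# + y) * (c * v))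

    ycv : y * (1# + y) * (c * v) ≈ (1# + y * c) * (y + t * c)
    ycv = lincomb (+-cong (+-cong (*-congˡ {y * (1# + y) * c} hv) (*-congˡ {c} (sym ht))) (*-congˡ {y} (hc)))
      (solve 5 (λ y z v t c →
        let s = con 1 :+ y; T = y :* s :* (z :* v) in
        y :* s :* (c :* v) :+ (y :* s :* c :* (con 1 :+ z :* v) :+ c :* t :+ y :* (con 1 :+ t :* (c :* c)))
        := (con 1 :+ y :* c) :* (y :+ t :* c) :+ (y :* s :* c :* v :+ c :* T :+ y :* c)) refl y z v t c)

    f≈ : f ≈ y + t * c
    f≈ = begin
      b * (y * (1# + y) * (c * v))        ≈⟨ *-congˡ ycv ⟩
      b * ((1# + y * c) * (y + t * c))    ≈⟨ *-assoc _ _ _ ⟨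
      b * (1# + y * c) * (y + t * c)      ≈⟨ *-congʳ hb ⟩
      1# * (y + t * c)                    ≈⟨ *-identityˡ _ ⟩
      y + t * c                           ∎

    -- Here a/c = 1/c + y and a′/c′ = 1/c′ + y, while 1/c + 1/c′ = 1.
    e+f : e + f ≈ 1# + (y + y)
    e+f = trans (+-congˡ f≈) (lincomb (+-cong (*-congˡ {y} uc) hu)
      (solve 4 (λ y t c u →
        (con 1 :+ y :* c) :* u :+ (y :+ t :* c) :+ (y :* con 1 :+ con 1)
        := con 1 :+ (y :+ y) :+ (y :* (u :* c) :+ (u :+ t :* c))) refl y t c u))

    -- The left side is z a a′ (1/c + 1/c′), and both z a a′ and the bracket equal 1.
    αf+be : α * f + b * e ≈ 1#
    αf+be = lincomb
      (+-cong (+-cong (*-congˡ {α} f≈) (*-congˡ {z} (sym ycv)))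
        (+-cong (*-congˡ {c} (sym ht)) (+-cong (*-congʳ {u} hb) hu)))
      (solve 7 (λ y z v t c b u →
        let s = con 1 :+ y; a = con 1 :+ y :* c; F = b :* (y :* s :* (c :* v)); T = y :* s :* (z :* v) in
        z :* a :* F :+ b :* (a :* u)
          :+ ((z :* a :* (y :+ t :* c) :+ z :* (y :* s :* (c :* v))) :+ (c :* t :+ (con 1 :* u :+ con 1)))
        := con 1 :+ ((z :* a :* F :+ z :* (a :* (y :+ t :* c))) :+ (c :* T :+ (b :* a :* u :+ (u :+ t :* c)))))
        refl y z v t c b u)

    -- α and b are the roots of ξ² - (α + b) ξ + z, and G j = zʲ (aʲ⁺¹/c + a′ʲ⁺¹/c′) with α = za and b = za′.
    G : ℕ → Carrier
    G j = α ^ j * e + b ^ j * f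

    G-0 : G 0 ≈ 1# + (y + y)
    G-0 = trans (+-cong (*-identityˡ _) (*-identityˡ _)) e+f

    G-1 : G 1 + 1# ≈ (α + b) * (1# + (y + y))
    G-1 = lincomb (+-cong (sym αf+be) (*-congˡ {α + b} e+f))
      (solve 5 (λ A b e f y →
         (A :* con 1 :* e :+ b :* con 1 :* f) :+ con 1 :+ ((A :* f :+ b :* e) :+ (A :+ b) :* (con 1 :+ (y :+ y)))
         := (A :+ b) :* (con 1 :+ (y :+ y)) :+ (con 1 :+ (A :+ b) :* (e :+ f))) refl α b e f y)

    G-rec : ∀ j → G (suc (suc j)) + z * G j ≈ (α + b) * G (suc j)
    G-rec j = lincomb (*-congʳ {G j} (sym αb))
      (solve 7 (λ A b z e f Aj bj →
         A :* (A :* Aj) :* e :+ b :* (b :* bj) :* f :+ z :* (Aj :* e :+ bj :* f)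
           :+ A :* b :* (Aj :* e :+ bj :* f)
         := (A :+ b) :* (A :* Aj :* e :+ b :* bj :* f) :+ z :* (Aj :* e :+ bj :* f)) refl α b z e f (α ^ j) (b ^ j))

    module Kernel (x w d : Carrier) (r : ℕ)
      (hx : x ≈ y * w)
      (hw : w * ((1# + y) ^ r * (1# + y) ^ r * (1# + y)) ≈ 1#)
      (hd : d ≈ b ^ r * b)
      where

      -- `M` is 1/((1-z)Q) written out factor by factor. Its factor w(1+y)ʳ is 1/(1+y)ʳ⁺¹, which is
      -- where the exponent 2r + 1 in the definition of y matters.
      Q M : Carrier
      Q = v * c * ((1# + y) ^ r * (1# + y)) * d
      M = w * (1# + y) ^ r * ((1# + y * c) ^ r * (1# + y * c)) * u

      MQ : M * Q ≈ v
      MQ = begin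
        M * Q
          ≈⟨ *-congˡ (*-congˡ hd) ⟩
        M * (v * c * ((1# + y) ^ r * (1# + y)) * (b ^ r * b))
          ≈⟨ solve 10 (λ w S s ar a u v c br b →
               w :* S :* (ar :* a) :* u :* (v :* c :* (S :* s) :* (br :* b))
               := w :* (S :* S :* s) :* (br :* ar) :* (b :* a) :* (u :* c) :* v) refl
               w ((1# + y) ^ r) (1# + y) ((1# + y * c) ^ r) (1# + y * c) u v c (b ^ r) b ⟩
        w * ((1# + y) ^ r * (1# + y) ^ r * (1# + y)) * (b ^ r * (1# + y * c) ^ r) * (b * (1# + y * c)) * (u * c) * v
          ≈⟨ *-congʳ (*-cong (*-cong (*-cong hw (^-inverse r hb)) hb) uc) ⟩
        1# * 1# * 1# * 1# * v
          ≈⟨ solve 1 (λ v → con 1 :* con 1 :* con 1 :* con 1 :* v := v) refl v ⟩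
        v ∎

      -- The root c contributes `z ^ r * M` to `G r`, and the conjugate root c′ contributes `x * Q`:
      -- the factor y of x completes b, c and v to `f`.
      xQ : x * Q + z ^ r * M ≈ w * (1# + y) ^ r * G r
      xQ = begin
        x * Q + z ^ r * M
          ≈⟨ +-congʳ (*-cong hx (*-congˡ hd)) ⟩
        y * w * (v * c * ((1# + y) ^ r * (1# + y)) * (b ^ r * b)) + z ^ r * M
          ≈⟨ solve 12 (λ y w v c S s br b zr ar a u →
               y :* w :* (v :* c :* (S :* s) :* (br :* b)) :+ zr :* (w :* S :* (ar :* a) :* u)
               := w :* S :* (zr :* ar :* (a :* u) :+ br :* (b :* (y :* s :* (c :* v))))) refl
               y w v c ((1# + y) ^ r) (1# + y) (b ^ r) b (z ^ r) ((1# + y * c) ^ r) (1# + y * c) u ⟩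
        w * (1# + y) ^ r * (z ^ r * (1# + y * c) ^ r * e + b ^ r * f)
          ≈⟨ *-congˡ (+-congʳ (*-congʳ (^-* z (1# + y * c) r))) ⟨
        w * (1# + y) ^ r * G r ∎

  -- The equations of the theorem in a form without subtraction. That the elements are power series
  -- enters only through the cancellation of x, z and 2.
  module System (x y z w t σ c q d : Carrier) (r : ℕ)
    (cancel-x : ∀ {F G} → x * F ≈ x * G → F ≈ G)
    (cancel-z : ∀ {F G} → z * F ≈ z * G → F ≈ G)
    (cancel-2 : ∀ {F G} → F + F ≈ G + G → F ≈ G)
    (hx : x ≈ y * w)
    (hw : w * (1# + y) ^ (2 ℕ.* r ℕ.+ 1) ≈ 1#)
    (ht : t ≈ t * z + y * (1# + y) * z)
    (hσ : σ * σ + (t + t + (t + t)) ≈ 1#)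
    (hc : (t + t) * c + σ ≈ 1#)
    (hq : q * (y * (1# + y)) ≈ t)
    (hd : d * (1# + y * c) ^ (r ℕ.+ 1) ≈ 1#)
    where

    ^-suc : ∀ F n → F ^ (n ℕ.+ 1) ≈ F ^ n * F
    ^-suc F n = trans (^-homo-* F n 1) (*-congˡ (*-identityʳ F))

    s v u b : Carrier
    s = 1# + y
    v = 1# + q
    u = 1# + - (t * c)
    b = d * (1# + y * c) ^ r

    hw′ : w * (s ^ r * s ^ r * s) ≈ 1#
    hw′ = begin
      w * (s ^ r * s ^ r * s)        ≈⟨ *-congˡ (*-congʳ (^-homo-* s r r)) ⟨
      w * (s ^ (r ℕ.+ r) * s)        ≈⟨ *-congˡ (^-suc s (r ℕ.+ r)) ⟨
      w * s ^ (r ℕ.+ r ℕ.+ 1)        ≡⟨ ≡.cong (λ m → w * s ^ (r ℕ.+ m ℕ.+ 1)) (≡.sym (ℕ.+-identityʳ r)) ⟩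
      w * s ^ (2 ℕ.* r ℕ.+ 1)        ≈⟨ hw ⟩
      1#                             ∎

    s⁻¹ : Carrier
    s⁻¹ = w * s ^ r * s ^ r

    s⁻¹s : s⁻¹ * s ≈ 1#
    s⁻¹s = trans (solve 3 (λ w S s → w :* S :* S :* s := w :* (S :* S :* s)) refl w (s ^ r) s) hw′

    cancel-y : ∀ {F G} → y * F ≈ y * G → F ≈ G
    cancel-y {F} {G} e = cancel-x (begin
      x * F        ≈⟨ *-congʳ hx ⟩
      y * w * F    ≈⟨ solve 3 (λ y w F → y :* w :* F := w :* (y :* F)) refl y w F ⟩
      w * (y * F)  ≈⟨ *-congˡ e ⟩
      w * (y * G)  ≈⟨ solve 3 (λ y w F → y :* w :* F := w :* (y :* F)) refl y w G ⟨
      y * w * G    ≈⟨ *-congʳ hx ⟨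
      x * G        ∎)

    hq′ : q ≈ z + z * q
    hq′ = cancel-y (unit-cancel s⁻¹ s s⁻¹s (lincomb
      (+-cong (+-cong hq ht) (*-congˡ {z} (sym hq)))
      (solve 4 (λ y z t q → let s = con 1 :+ y; p = q :* (y :* s) in
        s :* (y :* q) :+ (t :+ (t :* z :+ y :* s :* z) :+ z :* p)
        := s :* (y :* (z :+ z :* q)) :+ (p :+ t :+ z :* t)) refl y z t q)))

    hv : v ≈ 1# + z * v
    hv = +-congˡ (trans hq′ (solve 2 (λ z q → z :+ z :* q := z :* (con 1 :+ q)) refl z q))

    t≈ysvz : t ≈ y * s * (z * v)
    t≈ysvz = lincomb (+-cong ht (*-congˡ {z} (sym hq)))
      (solve 4 (λ y z t q → let s = con 1 :+ y; p = q :* (y :* s) in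
        t :+ (t :* z :+ y :* s :* z :+ z :* p) := y :* s :* (z :* (con 1 :+ q)) :+ (t :+ z :* t)) refl y z t q)

    -- Since t(1-z) = y(1+y)z, a common factor t can be exchanged for y(1+y)z, whose factors are all
    -- cancellable.
    cancel-t : ∀ {F G} → t * F ≈ t * G → F ≈ G
    cancel-t {F} {G} e = cancel-z (cancel-y (unit-cancel s⁻¹ s s⁻¹s (lincomb
      (+-cong (+-cong (*-congʳ {F} (sym ht)) (*-congʳ {G} ht)) (+-cong e (*-congˡ {z} (sym e))))
      (solve 5 (λ y z t F G → let s = con 1 :+ y; p = t :* z :+ y :* s :* z in
         s :* (y :* (z :* F)) :+ (t :* F :+ p :* G :+ (t :* G :+ z :* (t :* F)))
         := s :* (y :* (z :* G)) :+ (p :* F :+ t :* G :+ (t :* F :+ z :* (t :* G)))) refl y z t F G))))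

    -- With D = 2tc = 1 - σ, the identity D² + 4t = 2D is 4t times the quadratic equation of c.
    hc′ : c ≈ 1# + t * (c * c)
    hc′ = cancel-t (cancel-2 (cancel-2 (lincomb
      (+-cong (+-cong (sym hσ) (*-congˡ {D} (sym hc))) (+-cong (*-congˡ {σ} hc) hc))
      (solve 3 (λ t c σ → let D = (t :+ t) :* c; o = con 1; E = t :* (o :+ t :* (c :* c)) in
         (t :* c :+ t :* c) :+ (t :* c :+ t :* c)
           :+ ((σ :* σ :+ (t :+ t :+ (t :+ t))) :+ D :* (D :+ σ) :+ (σ :* o :+ o))
         := (E :+ E) :+ (E :+ E) :+ (o :+ D :* o :+ (σ :* (D :+ σ) :+ (D :+ σ)))) refl t c σ))))
      where
      D : Carrier
      D = (t + t) * c

    hu : u + t * c ≈ 1#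
    hu = trans (+-assoc _ _ _) (trans (+-congˡ (-‿inverseˡ _)) (+-identityʳ _))

    hb : b * (1# + y * c) ≈ 1#
    hb = trans (*-assoc _ _ _) (trans (*-congˡ (sym (^-suc _ r))) hd)

    hd′ : d ≈ b ^ r * b
    hd′ = unit-cancel d ((1# + y * c) ^ (r ℕ.+ 1)) hd (begin
      (1# + y * c) ^ (r ℕ.+ 1) * d             ≈⟨ trans (*-comm _ _) hd ⟩
      1#                                       ≈⟨ *-identityˡ _ ⟨
      1# * 1#                                  ≈⟨ *-cong (^-inverse r hb) hb ⟨
      b ^ r * a ^ r * (b * a)                  ≈⟨ solve 4 (λ B A b a → B :* A :* (b :* a) := A :* a :* (B :* b)) refl (b ^ r) (a ^ r) b a ⟩
      a ^ r * a * (b ^ r * b)                  ≈⟨ *-congʳ (^-suc _ r) ⟨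
      a ^ (r ℕ.+ 1) * (b ^ r * b)              ∎)
      where
      a : Carrier
      a = 1# + y * c

    open Roots y z v t c b u hv t≈ysvz hc′ hb hu public
    open Kernel x w d r hx hw′ hd′ public

    Q≈ : v * c * s ^ (r ℕ.+ 1) * d ≈ Q
    Q≈ = *-congʳ (*-congˡ (^-suc s r))

-- Opened here because the ring modules above use these names for ring operations and equality.
open import Data.Nat using (_+_; _*_)
open import Relation.Binary.PropositionalEquality
  using (_≡_; _≢_; refl; sym; trans; cong; cong₂; subst; subst₂; module ≡-Reasoning)

-- Bivariate series

module ℚ[[z]] = FormalPowerSeries ℚ.+-*-commutativeRing
module ℚ[[z]][[x]] = FormalPowerSeries ℚ[[z]].powerSeriesRing

sumTo≡∑ : ∀ n f → sumTo n f ≡ ℚ[[z]].∑ n f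
sumTo≡∑ zero f = refl
sumTo≡∑ (suc n) f = cong (ℚ._+ f (suc n)) (sumTo≡∑ n f)

sumTo-cong : ∀ n {f g : ℕ → ℚ} → (∀ i → f i ≡ g i) → sumTo n f ≡ sumTo n g
sumTo-cong zero e = e 0
sumTo-cong (suc n) e = cong₂ ℚ._+_ (sumTo-cong n e) (e (suc n))

sumTo-zero : ∀ n {f : ℕ → ℚ} → (∀ i → f i ≡ 0ℚ) → sumTo n f ≡ 0ℚ
sumTo-zero zero e = e 0
sumTo-zero (suc n) e = trans (cong₂ ℚ._+_ (sumTo-zero n e) (e (suc n))) (ℚ.+-identityʳ 0ℚ)

sumTo-head : ∀ n (f : ℕ → ℚ) → sumTo (suc n) f ≡ f 0 ℚ.+ sumTo n (λ i → f (suc i))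
sumTo-head n f = trans (sumTo≡∑ (suc n) f)
  (trans (ℚ[[z]].∑-head n f) (cong (f 0 ℚ.+_) (sym (sumTo≡∑ n _))))

sumTo-tail : ∀ n (f : ℕ → ℚ) → f 0 ≡ 0ℚ → sumTo (suc n) f ≡ sumTo n (λ i → f (suc i))
sumTo-tail n f e = trans (sumTo-head n f) (trans (cong (ℚ._+ sumTo n (λ i → f (suc i))) e) (ℚ.+-identityˡ _))

-- A `Series` is already an element of ℚ[[z̄]][[x]], with the outer index for x, so only the
-- products need comparing: the outer sum adds whole rows, and reading off one coefficient of a row
-- commutes with it.
⊗≗⋆ : ∀ F G → F ⊗ G ≗ˢ (F ℚ[[z]][[x]].⋆ G)
⊗≗⋆ F G n k = trans (sumTo-cong n (λ i → sumTo≡∑ k _)) (coefficient n _)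
  where
  coefficient : ∀ m (h : ℕ → ℕ → ℚ) → sumTo m (λ i → h i k) ≡ ℚ[[z]][[x]].∑ m h k
  coefficient zero h = refl
  coefficient (suc m) h = cong (ℚ._+ h (suc m) k) (coefficient m h)

𝟙≗one : 𝟙 ≗ˢ ℚ[[z]][[x]].one
𝟙≗one zero zero = refl
𝟙≗one zero (suc k) = refl
𝟙≗one (suc n) k = refl

seriesRing : CommutativeRing _ _
seriesRing = record
  { Carrier = Series ; _≈_ = _≗ˢ_ ; _+_ = _⊕_ ; _*_ = _⊗_ ; -_ = λ F n k → ℚ.- F n k
  ; 0# = λ _ _ → 0ℚ ; 1# = 𝟙
  ; isCommutativeRing = record
    { isRing = record
      { +-isAbelianGroup = R.+-isAbelianGroup
      ; *-cong = λ {F} {F′} {G} {G′} e e′ → via F G (via⁻ F′ G′ (R.*-cong {F} {F′} {G} {G′} e e′))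
      ; *-assoc = λ F G H → via (F ⊗ G) H (via⁻ F (G ⊗ H)
          (R.trans (R.*-congʳ {H} (⊗≗⋆ F G)) (R.trans (R.*-assoc F G H) (R.*-congˡ {F} (R.sym (⊗≗⋆ G H))))))
      ; *-identity = (λ F → via 𝟙 F (R.trans (R.*-congʳ {F} 𝟙≗one) (R.*-identityˡ F)))
                   , (λ F → via F 𝟙 (R.trans (R.*-congˡ {F} 𝟙≗one) (R.*-identityʳ F)))
      ; distrib = (λ H F G → via H (F ⊕ G) (R.trans (R.distribˡ H F G) (R.sym (R.+-cong (⊗≗⋆ H F) (⊗≗⋆ H G)))))
                , (λ H F G → via (F ⊕ G) H (R.trans (R.distribʳ H F G) (R.sym (R.+-cong (⊗≗⋆ F H) (⊗≗⋆ G H)))))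
      }
    ; *-comm = λ F G → via F G (via⁻ G F (R.*-comm F G))
    }
  }
  where
  module R = CommutativeRing ℚ[[z]][[x]].powerSeriesRing
  via : ∀ F G {H : Series} → (F ℚ[[z]][[x]].⋆ G) ≗ˢ H → F ⊗ G ≗ˢ H
  via F G e n k = trans (⊗≗⋆ F G n k) (e n k)
  via⁻ : ∀ F G {H : Series} → H ≗ˢ (F ℚ[[z]][[x]].⋆ G) → H ≗ˢ F ⊗ G
  via⁻ F G e n k = trans (e n k) (sym (⊗≗⋆ F G n k))

module ℛ = CommutativeRing seriesRing

X-suc : ∀ F n k → (X ⊗ F) (suc n) k ≡ F n k
X-suc F n k = trans
  (sumTo-tail n (λ i → sumTo k (λ j → X i j ℚ.* F (suc n ∸ i) (k ∸ j))) (sumTo-zero k (λ j → ℚ.*-zeroˡ (F (suc n) (k ∸ j)))))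
  -- By computation `X (suc i) j` is `𝟙 i j`, so the sum that remains is a coefficient of `𝟙 ⊗ F`.
  -- The same happens for `Z`.
  (ℛ.*-identityˡ F n k)

X-zero : ∀ F k → (X ⊗ F) 0 k ≡ 0ℚ
X-zero F k = sumTo-zero k (λ j → ℚ.*-zeroˡ (F 0 (k ∸ j)))

Z-0 : ∀ i → Z i 0 ≡ 0ℚ
Z-0 zero = refl
Z-0 (suc i) = refl

Z-suc : ∀ F n k → (Z ⊗ F) n (suc k) ≡ F n k
Z-suc F n k = trans
  (sumTo-cong n (λ i → sumTo-tail k (λ j → Z i j ℚ.* F (n ∸ i) (suc k ∸ j))
    (trans (cong (ℚ._* F (n ∸ i) (suc k)) (Z-0 i)) (ℚ.*-zeroˡ (F (n ∸ i) (suc k))))))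
  (ℛ.*-identityˡ F n k)

Z-zero : ∀ F n → (Z ⊗ F) n 0 ≡ 0ℚ
Z-zero F n = sumTo-zero n (λ i → trans (cong (ℚ._* F (n ∸ i) 0) (Z-0 i)) (ℚ.*-zeroˡ (F (n ∸ i) 0)))

Z^-+ : ∀ r F n k → (Z ^ˢ r ⊗ F) n (r ℕ.+ k) ≡ F n k
Z^-+ zero F n k = ℛ.*-identityˡ F n k
Z^-+ (suc r) F n k = trans (ℛ.*-assoc Z (Z ^ˢ r) F n (suc (r ℕ.+ k)))
  (trans (Z-suc (Z ^ˢ r ⊗ F) n (r ℕ.+ k)) (Z^-+ r F n k))

X-cancel : ∀ {F G} → X ⊗ F ≗ˢ X ⊗ G → F ≗ˢ G
X-cancel {F} {G} e n k = trans (sym (X-suc F n k)) (trans (e (suc n) k) (X-suc G n k))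

Z-cancel : ∀ {F G} → Z ⊗ F ≗ˢ Z ⊗ G → F ≗ˢ G
Z-cancel {F} {G} e n k = trans (sym (Z-suc F n k)) (trans (e n (suc k)) (Z-suc G n k))

ℚ-double-cancel : ∀ {p q : ℚ} → p ℚ.+ p ≡ q ℚ.+ q → p ≡ q
ℚ-double-cancel {p} {q} e = trans (sym (half p)) (trans (cong (ℚ._* ℚ.½) e) (half q))
  where
  half : ∀ p → (p ℚ.+ p) ℚ.* ℚ.½ ≡ p
  half p = trans (ℚ.*-distribʳ-+ ℚ.½ p p) (trans (sym (ℚ.*-distribˡ-+ p ℚ.½ ℚ.½)) (ℚ.*-identityʳ p))

-- The degree is taken in z̄ alone, so `Degree≤ 0` singles out the series in x.
Degree≤ : ℕ → Series → Set
Degree≤ d F = ∀ n k → d ℕ.< k → F n k ≡ 0ℚ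

deg-resp : ∀ {d F G} → F ≗ˢ G → Degree≤ d F → Degree≤ d G
deg-resp e p n k d<k = trans (sym (e n k)) (p n k d<k)

deg-mono : ∀ {d e F} → d ℕ.≤ e → Degree≤ d F → Degree≤ e F
deg-mono d≤e p n k e<k = p n k (ℕ.≤-<-trans d≤e e<k)

deg-⊕ : ∀ {d F G} → Degree≤ d F → Degree≤ d G → Degree≤ d (F ⊕ G)
deg-⊕ p q n k d<k = cong₂ ℚ._+_ (p n k d<k) (q n k d<k)

-- The identities for `α ⊕ b` and for `G` carry the term to be subtracted on their left side; this
-- is how its degree is discounted.
deg-⊕⁻ : ∀ {d F G} → Degree≤ d (F ⊕ G) → Degree≤ d G → Degree≤ d F
deg-⊕⁻ {d} {F} {G} p q n k d<k = trans (sym (ℚ.+-identityʳ (F n k)))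
  (trans (cong (F n k ℚ.+_) (sym (q n k d<k))) (p n k d<k))

deg-⊗ : ∀ {d e F G} → Degree≤ d F → Degree≤ e G → Degree≤ (d ℕ.+ e) (F ⊗ G)
deg-⊗ {d} {e} {F} {G} p q n k d+e<k = sumTo-zero n (λ i → sumTo-zero k (λ j → term i j))
  where
  term : ∀ i j → F i j ℚ.* G (n ∸ i) (k ∸ j) ≡ 0ℚ
  term i j with d ℕ.<? j
  ... | yes d<j = trans (cong (ℚ._* G (n ∸ i) (k ∸ j)) (p i j d<j)) (ℚ.*-zeroˡ (G (n ∸ i) (k ∸ j)))
  ... | no d≮j = trans (cong (F i j ℚ.*_) (q (n ∸ i) (k ∸ j) e<k∸j)) (ℚ.*-zeroʳ (F i j))
    where
    e<k∸j : e ℕ.< k ∸ j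
    e<k∸j = ℕ.m+n≤o⇒m≤o∸n (suc e) (ℕ.≤-<-trans (ℕ.≤-trans (ℕ.+-monoʳ-≤ e (ℕ.≮⇒≥ d≮j)) (ℕ.≤-reflexive (ℕ.+-comm e d))) d+e<k)

deg-𝟙 : Degree≤ 0 𝟙
deg-𝟙 zero (suc k) _ = refl
deg-𝟙 (suc n) (suc k) _ = refl

deg-Z : Degree≤ 1 Z
deg-Z zero (suc (suc k)) _ = refl
deg-Z zero (suc zero) (s≤s ())
deg-Z (suc n) k _ = refl

deg-^ : ∀ {F} → Degree≤ 0 F → ∀ e → Degree≤ 0 (F ^ˢ e)
deg-^ p zero = deg-𝟙
deg-^ p (suc e) = deg-⊗ p (deg-^ p e)

-- Dropping the z̄⁰ coefficients is linear over ℚ[[x]], so it sends F ⊗ G ≗ˢ 𝟙 to F ⊗ (dropped G) ≗ˢ 0.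
deg-inverse : ∀ {F G} → Degree≤ 0 F → G ⊗ F ≗ˢ 𝟙 → Degree≤ 0 G
deg-inverse {F} {G} p e = λ { n (suc k) _ → dropped≗0 n (suc k) }
  where
  dropped : Series
  dropped n zero = 0ℚ
  dropped n (suc k) = G n (suc k)

  free : ∀ H n k → (F ⊗ H) n k ≡ sumTo n (λ i → F i 0 ℚ.* H (n ∸ i) k)
  free H n k = sumTo-cong n (λ i → inner i k)
    where
    inner : ∀ i k → sumTo k (λ j → F i j ℚ.* H (n ∸ i) (k ∸ j)) ≡ F i 0 ℚ.* H (n ∸ i) k
    inner i zero = refl
    inner i (suc k) = trans (sumTo-head k (λ j → F i j ℚ.* H (n ∸ i) (suc k ∸ j))) (trans (cong (F i 0 ℚ.* H (n ∸ i) (suc k) ℚ.+_)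
      (sumTo-zero k (λ j → trans (cong (ℚ._* H (n ∸ i) (k ∸ j)) (p i (suc j) (s≤s z≤n))) (ℚ.*-zeroˡ (H (n ∸ i) (k ∸ j))))))
      (ℚ.+-identityʳ _))

  F⊗dropped : F ⊗ dropped ≗ˢ F ⊗ ℛ.0#
  F⊗dropped n zero = trans (free dropped n 0) (trans (sumTo-zero n (λ i → ℚ.*-zeroʳ (F i 0))) (sym (ℛ.zeroʳ F n 0)))
  F⊗dropped n (suc k) = trans (free dropped n (suc k)) (trans (sym (free G n (suc k)))
    (trans (ℛ.*-comm F G n (suc k)) (trans (e n (suc k)) (trans (deg-𝟙 n (suc k) (s≤s z≤n)) (sym (ℛ.zeroʳ F n (suc k)))))))

  dropped≗0 : dropped ≗ˢ ℛ.0#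
  dropped≗0 = Identities.unit-cancel seriesRing G F e F⊗dropped

-- The recurrence and its closed-form solution

-- In the convolution, the index `suc k` is the position, counted from 1, of the component that
-- contains the largest letter. There is no position 0, which removes the coefficients of `F` up to
-- z̄ʳ.
shift : ℕ → Series → Series
shift r F n zero = 0ℚ
shift r F n (suc k) = F n (r + suc k)

record Recurrence (r : ℕ) (F : Series) : Set where
  field
    initial : ∀ k → F 0 k ≡ 1ℚ
    step : ∀ n k → F (suc n) k ≡ (shift r F ⊗ F) n k

sumTo-cong-≤ : ∀ n {f g : ℕ → ℚ} → (∀ i → i ≤ n → f i ≡ g i) → sumTo n f ≡ sumTo n g
sumTo-cong-≤ zero e = e 0 z≤n
sumTo-cong-≤ (suc n) e = cong₂ ℚ._+_ (sumTo-cong-≤ n (λ i i≤n → e i (ℕ.m≤n⇒m≤1+n i≤n))) (e (suc n) ℕ.≤-refl)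

-- `step` leads from row n + 1 to rows up to n, but in columns raised by r, so the induction on n
-- has to treat all k at once.
recurrence-unique : ∀ {r F G} → Recurrence r F → Recurrence r G → F ≗ˢ G
recurrence-unique {r} {F} {G} p q = <-rec (λ n → ∀ k → F n k ≡ G n k) induct
  where
  module p = Recurrence p
  module q = Recurrence q
  induct : ∀ n → (∀ {m} → m ℕ.< n → ∀ k → F m k ≡ G m k) → ∀ k → F n k ≡ G n k
  induct zero IH k = trans (p.initial k) (sym (q.initial k))
  induct (suc n) IH k = trans (p.step n k) (trans
    (sumTo-cong-≤ n (λ i i≤n → sumTo-cong k (λ j →
      cong₂ ℚ._*_ (shifted i≤n j) (IH (s≤s (ℕ.m∸n≤m n i)) (k ∸ j)))))
    (sym (q.step n k)))
    where
    shifted : ∀ {i} → i ≤ n → ∀ j → shift r F i j ≡ shift r G i j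
    shifted i≤n zero = refl
    shifted i≤n (suc j) = IH (s≤s i≤n) (r + suc j)

-- Since X ⊗ Q ⊕ Z ^ˢ r ⊗ M has degree at most r in z̄, its coefficients beyond z̄ʳ say X ⊗ shift r Q ⊕ M ≗ˢ 𝟙.
kernel⇒recurrence : ∀ r {Q M H v} → X ⊗ Q ⊕ Z ^ˢ r ⊗ M ≗ˢ H → Degree≤ r H → M ⊗ Q ≗ˢ v →
  v ≗ˢ 𝟙 ⊕ Z ⊗ v → (∀ n → M n 0 ≡ 𝟙 n 0) → Recurrence r Q
kernel⇒recurrence r {Q} {M} {H} {v} hH dH hM hv M₀ = record
  { initial = λ k → trans (Q≗ 0 k) (trans (cong₂ ℚ._+_ (X-zero (shift r Q ⊗ Q) k) (v-0 k)) (ℚ.+-identityˡ 1ℚ))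
  ; step = λ n k → trans (Q≗ (suc n) k)
      (trans (cong₂ ℚ._+_ (X-suc (shift r Q ⊗ Q) n k) (v-suc n k)) (ℚ.+-identityʳ _))
  }
  where
  v-0 : ∀ k → v 0 k ≡ 1ℚ
  v-0 zero = trans (hv 0 0) (trans (cong (1ℚ ℚ.+_) (Z-zero v 0)) (ℚ.+-identityʳ 1ℚ))
  v-0 (suc k) = trans (hv 0 (suc k)) (trans (ℚ.+-identityˡ _) (trans (Z-suc v 0 k) (v-0 k)))

  v-suc : ∀ n k → v (suc n) k ≡ 0ℚ
  v-suc n zero = trans (hv (suc n) 0) (trans (ℚ.+-identityˡ _) (Z-zero v (suc n)))
  v-suc n (suc k) = trans (hv (suc n) (suc k)) (trans (ℚ.+-identityˡ _) (trans (Z-suc v (suc n) k) (v-suc n k)))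

  X⊗shift : ∀ n k → (X ⊗ shift r Q) n (suc k) ≡ (X ⊗ Q) n (r + suc k)
  X⊗shift zero k = trans (X-zero (shift r Q) (suc k)) (sym (X-zero Q (r + suc k)))
  X⊗shift (suc n) k = trans (X-suc (shift r Q) n (suc k)) (sym (X-suc Q n (r + suc k)))

  X⊗shift-0 : ∀ n → (X ⊗ shift r Q) n 0 ≡ 0ℚ
  X⊗shift-0 zero = X-zero (shift r Q) 0
  X⊗shift-0 (suc n) = X-suc (shift r Q) n 0

  unit : X ⊗ shift r Q ⊕ M ≗ˢ 𝟙
  -- At z̄⁰ the degree bound gives nothing; here the value of `M` at z̄ = 0 is used.
  unit n zero = trans (cong₂ ℚ._+_ (X⊗shift-0 n) (M₀ n)) (ℚ.+-identityˡ _)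
  unit n (suc k) = begin
    (X ⊗ shift r Q) n (suc k) ℚ.+ M n (suc k)
      ≡⟨ cong₂ ℚ._+_ (X⊗shift n k) (sym (Z^-+ r M n (suc k))) ⟩
    (X ⊗ Q ⊕ Z ^ˢ r ⊗ M) n (r + suc k)
      ≡⟨ hH n (r + suc k) ⟩
    H n (r + suc k)
      ≡⟨ dH n (r + suc k) (ℕ.m<m+n r (s≤s z≤n)) ⟩
    0ℚ
      ≡⟨ deg-𝟙 n (suc k) (s≤s z≤n) ⟨
    𝟙 n (suc k) ∎
    where open ≡-Reasoning

  -- Multiplying `unit` by `Q` leaves v = 1/(1-z̄), whose coefficients are 1 in row 0 and 0
  -- elsewhere. Row 0 then gives `initial`, and the other rows give `step`.
  Q≗ : Q ≗ˢ X ⊗ (shift r Q ⊗ Q) ⊕ v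
  Q≗ = begin
    Q                                     ≈⟨ ℛ.*-identityˡ Q ⟨
    𝟙 ⊗ Q                                 ≈⟨ ℛ.*-congʳ {Q} unit ⟨
    (X ⊗ shift r Q ⊕ M) ⊗ Q               ≈⟨ ℛ.distribʳ Q (X ⊗ shift r Q) M ⟩
    X ⊗ shift r Q ⊗ Q ⊕ M ⊗ Q             ≈⟨ ℛ.+-cong (ℛ.*-assoc X (shift r Q) Q) hM ⟩
    X ⊗ (shift r Q ⊗ Q) ⊕ v               ∎
    where
    open SetoidReasoning ℛ.setoid

infix 4 _≈₀_
-- Equality at z̄ = 0, introduced to evaluate `M` there.
_≈₀_ : Series → Series → Set
F ≈₀ G = ∀ n → F n 0 ≡ G n 0

≈₀-⊗ : ∀ {F F′ G G′} → F ≈₀ F′ → G ≈₀ G′ → F ⊗ G ≈₀ F′ ⊗ G′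
≈₀-⊗ p q n = sumTo-cong n (λ i → cong₂ ℚ._*_ (p i) (q (n ∸ i)))

≈₀-^ : ∀ {F G} → F ≈₀ G → ∀ e → F ^ˢ e ≈₀ G ^ˢ e
≈₀-^ p zero n = refl
≈₀-^ {F} {G} p (suc e) = ≈₀-⊗ {F} {G} {F ^ˢ e} {G ^ˢ e} p (≈₀-^ {F} {G} p e)

open Exp ℛ.semiring using (_^_)

^≗^ˢ : ∀ F e → F ^ e ≗ˢ F ^ˢ e
^≗^ˢ F zero n k = refl
^≗^ˢ F (suc e) = ℛ.*-congˡ {F} (^≗^ˢ F e)

module ClosedForm (r : ℕ)
  (y : Series) (y-free : ∀ n k → y n (suc k) ≡ 0ℚ)
  (w : Series) (hw : w ⊗ (𝟙 ⊕ y) ^ˢ (2 * r + 1) ≗ˢ 𝟙)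
  (hX : X ≗ˢ y ⊗ w)
  (t : Series) (ht : t ⊗ (𝟙 ⊖ Z) ≗ˢ y ⊗ (𝟙 ⊕ y) ⊗ Z)
  (σ : Series) (hσ : σ ⊗ σ ≗ˢ 𝟙 ⊖ ℕ→ℚ 4 ·ˢ t)
  (c : Series) (hc : ℕ→ℚ 2 ·ˢ t ⊗ c ≗ˢ 𝟙 ⊖ σ)
  (q : Series) (hq : q ⊗ (y ⊗ (𝟙 ⊕ y)) ≗ˢ t)
  (d : Series) (hd : d ⊗ (𝟙 ⊕ y ⊗ c) ^ˢ (r + 1) ≗ˢ 𝟙)
  where

  open Identities seriesRing using (module System)

  move : ∀ A B C → A ≗ˢ B ⊖ C → A ⊕ C ≗ˢ B
  move A B C e = ℛ.trans (ℛ.+-congʳ {C} e) (ℛ.trans (ℛ.+-assoc B (ℛ.- C) C)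
    (ℛ.trans (ℛ.+-congˡ {B} (ℛ.-‿inverseˡ C)) (ℛ.+-identityʳ B)))

  two : ℕ→ℚ 2 ·ˢ t ≗ˢ t ⊕ t
  two n k = trans (ℚ.*-distribʳ-+ (t n k) 1ℚ 1ℚ) (cong₂ ℚ._+_ (ℚ.*-identityˡ (t n k)) (ℚ.*-identityˡ (t n k)))

  four : ℕ→ℚ 4 ·ˢ t ≗ˢ t ⊕ t ⊕ (t ⊕ t)
  four n k = trans (ℚ.*-distribʳ-+ (t n k) (ℕ→ℚ 2) (ℕ→ℚ 2)) (cong₂ ℚ._+_ (two n k) (two n k))

  t-equation : t ≗ˢ t ⊗ Z ⊕ y ⊗ (𝟙 ⊕ y) ⊗ Z
  t-equation n k = trans (sym (move (t ⊗ (𝟙 ⊖ Z)) t (t ⊗ Z) split n k))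
     (trans (cong (ℚ._+ (t ⊗ Z) n k) (ht n k)) (ℚ.+-comm ((y ⊗ (𝟙 ⊕ y) ⊗ Z) n k) ((t ⊗ Z) n k)))
    where
    split : t ⊗ (𝟙 ⊖ Z) ≗ˢ t ⊖ t ⊗ Z
    split = ℛ.trans (ℛ.distribˡ t 𝟙 (ℛ.- Z)) (ℛ.+-cong (ℛ.*-identityʳ t)
      (ℛ.sym (-‿distribʳ-* t Z)))
      where open import Algebra.Properties.Ring ℛ.ring using (-‿distribʳ-*)

  X-cancel′ : ∀ {F G} → X ⊗ F ≗ˢ X ⊗ G → F ≗ˢ G
  X-cancel′ {F} {G} = X-cancel {F} {G}

  Z-cancel′ : ∀ {F G} → Z ⊗ F ≗ˢ Z ⊗ G → F ≗ˢ G
  Z-cancel′ {F} {G} = Z-cancel {F} {G}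

  double-cancel : ∀ {F G} → F ⊕ F ≗ˢ G ⊕ G → F ≗ˢ G
  double-cancel e n k = ℚ-double-cancel (e n k)

  w-equation : w ⊗ (𝟙 ⊕ y) ^ (2 * r + 1) ≗ˢ 𝟙
  w-equation = ℛ.trans (ℛ.*-congˡ {w} (^≗^ˢ (𝟙 ⊕ y) (2 * r + 1))) hw

  σ-equation : σ ⊗ σ ⊕ (t ⊕ t ⊕ (t ⊕ t)) ≗ˢ 𝟙
  σ-equation = ℛ.trans (ℛ.+-congˡ {σ ⊗ σ} (ℛ.sym four)) (move (σ ⊗ σ) 𝟙 (ℕ→ℚ 4 ·ˢ t) hσ)

  c-equation : (t ⊕ t) ⊗ c ⊕ σ ≗ˢ 𝟙
  c-equation = ℛ.trans (ℛ.+-congʳ {σ} (ℛ.*-congʳ {c} (ℛ.sym two))) (move (ℕ→ℚ 2 ·ˢ t ⊗ c) 𝟙 σ hc)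

  d-equation : d ⊗ (𝟙 ⊕ y ⊗ c) ^ (r + 1) ≗ˢ 𝟙
  d-equation = ℛ.trans (ℛ.*-congˡ {d} (^≗^ˢ (𝟙 ⊕ y ⊗ c) (r + 1))) hd

  open System X y Z w t σ c q d r X-cancel′ Z-cancel′ double-cancel
    hX w-equation t-equation σ-equation c-equation hq d-equation

  deg-y : Degree≤ 0 y
  deg-y n (suc k) _ = y-free n k

  deg-s : Degree≤ 0 s
  deg-s = deg-⊕ {F = 𝟙} deg-𝟙 deg-y

  deg-s^ : ∀ e → Degree≤ 0 (s ^ e)
  deg-s^ e = deg-resp (ℛ.sym (^≗^ˢ s e)) (deg-^ deg-s e)

  deg-w : Degree≤ 0 w
  deg-w = deg-inverse (deg-^ deg-s (2 * r + 1)) hw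

  deg-Z⊗ : ∀ {e F} → Degree≤ e F → Degree≤ (suc e) (Z ⊗ F)
  deg-Z⊗ = deg-⊗ deg-Z

  -- `α+b` makes (1+y)(α + b) linear in z̄, and dividing by 1 + y keeps the degree because 1/(1+y)
  -- is again free of z̄.
  deg-α⊕b : Degree≤ 1 (α ⊕ b)
  deg-α⊕b = deg-resp s⁻¹⊗s⊗ (deg-⊗ {F = s⁻¹} {G = s ⊗ (α ⊕ b)} (deg-inverse {G = s⁻¹} deg-s s⁻¹s)
    (deg-⊕⁻ {F = s ⊗ (α ⊕ b)} (deg-resp (ℛ.sym α+b)
      (deg-⊕ {F = (Z ⊕ Z) ⊗ s} (deg-⊗ {1} {0} (deg-⊕ {F = Z} deg-Z deg-Z) deg-s) (deg-mono {F = 𝟙} z≤n deg-𝟙)))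
      deg-Z))
    where
    s⁻¹⊗s⊗ : s⁻¹ ⊗ (s ⊗ (α ⊕ b)) ≗ˢ α ⊕ b
    s⁻¹⊗s⊗ = ℛ.trans (ℛ.sym (ℛ.*-assoc s⁻¹ s (α ⊕ b)))
      (ℛ.trans (ℛ.*-congʳ {α ⊕ b} s⁻¹s) (ℛ.*-identityˡ (α ⊕ b)))

  deg-1+2y : Degree≤ 0 (𝟙 ⊕ (y ⊕ y))
  deg-1+2y = deg-⊕ {F = 𝟙} deg-𝟙 (deg-⊕ {F = y} deg-y deg-y)

  -- `G-rec` has order two, so the induction carries two consecutive bounds.
  deg-G : ∀ j → Degree≤ j (G j) × Degree≤ (suc j) (G (suc j))
  deg-G zero = deg-resp (ℛ.sym G-0) deg-1+2y
             , deg-⊕⁻ {F = G 1} (deg-resp (ℛ.sym G-1) (deg-⊗ {1} {0} deg-α⊕b deg-1+2y)) (deg-mono {F = 𝟙} z≤n deg-𝟙)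
  deg-G (suc j) with deg-G j
  ... | p , p′ = p′ , deg-⊕⁻ {F = G (suc (suc j))} (deg-resp (ℛ.sym (G-rec j)) (deg-⊗ deg-α⊕b p′))
                        (deg-mono {F = Z ⊗ G j} (ℕ.n≤1+n (suc j)) (deg-Z⊗ p))

  t₀ : t ≈₀ ℛ.0#
  t₀ n = trans (t≈ysvz n 0) (trans (≈₀-⊗ {y ⊗ s} {y ⊗ s} {Z ⊗ v} {ℛ.0#} (λ _ → refl) (Z-zero v) n) (ℛ.zeroʳ (y ⊗ s) n 0))

  t⊗₀ : ∀ F → t ⊗ F ≈₀ ℛ.0#
  t⊗₀ F n = trans (≈₀-⊗ {t} {ℛ.0#} {F} {F} t₀ (λ _ → refl) n) (ℛ.zeroˡ F n 0)

  c₀ : c ≈₀ 𝟙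
  c₀ n = trans (hc′ n 0) (trans (cong (𝟙 n 0 ℚ.+_) (t⊗₀ (c ⊗ c) n)) (ℚ.+-identityʳ _))

  u₀ : u ≈₀ 𝟙
  u₀ n = trans (sym (ℚ.+-identityʳ _)) (trans (cong (u n 0 ℚ.+_) (sym (t⊗₀ c n))) (hu n 0))

  1+yc₀ : 𝟙 ⊕ y ⊗ c ≈₀ s
  1+yc₀ n = cong (𝟙 n 0 ℚ.+_) (trans (≈₀-⊗ {y} {y} {c} {𝟙} (λ _ → refl) c₀ n) (ℛ.*-identityʳ y n 0))

  1+yc^r₀ : (𝟙 ⊕ y ⊗ c) ^ r ≈₀ s ^ r
  1+yc^r₀ n = trans (^≗^ˢ (𝟙 ⊕ y ⊗ c) r n 0) (trans (≈₀-^ {𝟙 ⊕ y ⊗ c} {s} 1+yc₀ r n) (sym (^≗^ˢ s r n 0)))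

  -- At z̄ = 0 the series t vanishes, so c = u = 1 and 1 + yc = 1 + y; then `M` collapses to
  -- w(1+y)²ʳ⁺¹.
  M₀ : M ≈₀ 𝟙
  M₀ n = trans
    (≈₀-⊗ {w ⊗ s ^ r ⊗ ((𝟙 ⊕ y ⊗ c) ^ r ⊗ (𝟙 ⊕ y ⊗ c))} {w ⊗ s ^ r ⊗ (s ^ r ⊗ s)} {u} {𝟙}
      (≈₀-⊗ {w ⊗ s ^ r} {w ⊗ s ^ r} {(𝟙 ⊕ y ⊗ c) ^ r ⊗ (𝟙 ⊕ y ⊗ c)} {s ^ r ⊗ s} (λ _ → refl) (≈₀-⊗ {(𝟙 ⊕ y ⊗ c) ^ r} {s ^ r} {𝟙 ⊕ y ⊗ c} {s} 1+yc^r₀ 1+yc₀)) u₀ n)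
    (simplify n 0)
    where
    simplify : w ⊗ s ^ r ⊗ (s ^ r ⊗ s) ⊗ 𝟙 ≗ˢ 𝟙
    simplify = ℛ.trans (ℛ.*-identityʳ (w ⊗ s ^ r ⊗ (s ^ r ⊗ s))) (ℛ.trans (ℛ.sym (ℛ.*-assoc (w ⊗ s ^ r) (s ^ r) s)) s⁻¹s)

  recurrence : Recurrence r Q
  recurrence = kernel⇒recurrence r {Q} {M} {w ⊗ s ^ r ⊗ G r} {v}
    (ℛ.trans (ℛ.+-congˡ {X ⊗ Q} (ℛ.*-congʳ {M} (ℛ.sym (^≗^ˢ Z r)))) xQ)
    (deg-⊗ {F = w ⊗ s ^ r} {G r} (deg-⊗ {F = w} {s ^ r} deg-w (deg-s^ r)) (proj₁ (deg-G r)))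
    MQ hv M₀

  closed-form : (𝟙 ⊕ q) ⊗ c ⊗ (𝟙 ⊕ y) ^ˢ (r + 1) ⊗ d ≗ˢ Q
  closed-form = ℛ.trans (ℛ.*-congʳ {d} (ℛ.*-congˡ {v ⊗ c} (ℛ.sym (^≗^ˢ s (r + 1))))) Q≈

-- Stack sorting

≡ᵇ-true⇒≡ : ∀ a b → (a ≡ᵇ b) ≡ true → a ≡ b
≡ᵇ-true⇒≡ a b e = ℕ.≡ᵇ⇒≡ a b (subst T (sym e) tt)

≡ᵇ-refl : ∀ a → (a ≡ᵇ a) ≡ true
≡ᵇ-refl zero = refl
≡ᵇ-refl (suc a) = ≡ᵇ-refl a

≢⇒≡ᵇ-false : ∀ a b → a ≢ b → (a ≡ᵇ b) ≡ false
≢⇒≡ᵇ-false a b a≢b with a ≡ᵇ b in e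
... | true = contradiction (≡ᵇ-true⇒≡ a b e) a≢b
... | false = refl

≡ᵇ-false⇒≢ : ∀ a b → (a ≡ᵇ b) ≡ false → a ≢ b
≡ᵇ-false⇒≢ a .a e refl with () ← trans (sym e) (≡ᵇ-refl a)

concat-++ : ∀ {A : Set} (us vs : List (List A)) → concat (us ++ vs) ≡ concat us ++ concat vs
concat-++ us vs = sym (List.concat-++ us vs)

-- The offset anticipates the decomposition: the components to the right of the largest letter use
-- an upper interval of letters and are not relabelled.
range : ℕ → ℕ → List ℕ
range off zero = []
range off (suc n) = suc off ∷ range (suc off) n

range-++ : ∀ off m n → range off (m + n) ≡ range off m ++ range (off + m) n
range-++ off zero n = cong (λ o → range o n) (sym (ℕ.+-identityʳ off))
range-++ off (suc m) n = cong (suc off ∷_) (trans (range-++ (suc off) m n)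
  (cong (λ o → range (suc off) m ++ range o n) (sym (ℕ.+-suc off m))))

range-snoc : ∀ off n → range off (suc n) ≡ range off n ++ [ off + suc n ]
range-snoc off n = trans (cong (range off) (ℕ.+-comm 1 n))
  (trans (range-++ off n 1) (cong (λ x → range off n ++ [ x ]) (sym (ℕ.+-suc off n))))

range1≡range : ∀ n → range1 n ≡ range 0 n
range1≡range zero = refl
range1≡range (suc n) = trans (cong (_++ [ suc n ]) (range1≡range n)) (sym (range-snoc 0 n))

length-range : ∀ off n → length (range off n) ≡ n
length-range off zero = refl
length-range off (suc n) = cong suc (length-range (suc off) n)

∈-range⁻ : ∀ {off n x} → x ∈ range off n → off < x × x ≤ off + n
∈-range⁻ {off} {suc n} (here refl) = ℕ.≤-refl , ℕ.≤-trans (ℕ.m≤m+n (suc off) n) (ℕ.≤-reflexive (sym (ℕ.+-suc off n)))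
∈-range⁻ {off} {suc n} {x} (there x∈) with ∈-range⁻ x∈
... | p , q = ℕ.<-trans (ℕ.n<1+n off) p , subst (x ≤_) (sym (ℕ.+-suc off n)) q

∈-range⁺ : ∀ {off n x} → off < x → x ≤ off + n → x ∈ range off n
∈-range⁺ {off} {zero} {x} p q = contradiction (ℕ.≤-trans q (ℕ.≤-reflexive (ℕ.+-identityʳ off))) (ℕ.<⇒≱ p)
∈-range⁺ {off} {suc n} {x} p q with suc off ℕ.≟ x
... | yes refl = here refl
... | no ≢ = there (∈-range⁺ (ℕ.≤∧≢⇒< p ≢) (subst (x ≤_) (ℕ.+-suc off n) q))

-- Applied to S(u)S(v), this is what forces the letters to the left of N to be the smallest ones.
range-split : ∀ off n u v → u ++ v ≡ range off n →
  u ≡ range off (length u) × v ≡ range (off + length u) (length v) × length u + length v ≡ n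
range-split off n [] v e = refl
  , trans e (cong₂ range (sym (ℕ.+-identityʳ off)) (sym len)) , len
  where
  len : length v ≡ n
  len = trans (cong length e) (length-range off n)
range-split off (suc n) (a ∷ u) v e with List.∷-injective e
... | refl , e′ with range-split (suc off) n u v e′
... | p , q , l = cong (suc off ∷_) p , trans q (cong (λ o → range o (length v)) (sym (ℕ.+-suc off (length u)))) , cong suc l

occ-hit : ∀ x a w → (x ≡ᵇ a) ≡ true → occ x (a ∷ w) ≡ suc (occ x w)
occ-hit x a w e rewrite e = refl

occ-miss : ∀ x a w → (x ≡ᵇ a) ≡ false → occ x (a ∷ w) ≡ occ x w
occ-miss x a w e rewrite e = refl

occ-++ : ∀ x u v → occ x (u ++ v) ≡ occ x u + occ x v
occ-++ x [] v = refl
occ-++ x (a ∷ u) v with x ≡ᵇ a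
... | true = cong suc (occ-++ x u v)
... | false = occ-++ x u v

occ-∉ : ∀ {x} w → x ∉ w → occ x w ≡ 0
occ-∉ [] _ = refl
occ-∉ {x} (a ∷ w) x∉ with x ≡ᵇ a in e
... | true = contradiction (here (≡ᵇ-true⇒≡ x a e)) x∉
... | false = occ-∉ w (x∉ ∘ there)

-- Splitting a word at a letter

join : ℕ → List (List ℕ) → List ℕ
join N [] = []
join N (β ∷ []) = β
join N (β ∷ β′ ∷ βs) = β ++ N ∷ join N (β′ ∷ βs)

Absent : ℕ → List (List ℕ) → Set
Absent N = All (N ∉_)

absent-concat : ∀ {N} βs → N ∉ concat βs → Absent N βs
absent-concat [] _ = []
absent-concat (β ∷ βs) N∉ = (N∉ ∘ ∈-++⁺ˡ) ∷ absent-concat βs (N∉ ∘ ∈-++⁺ʳ β)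

record IsSplit (N : ℕ) (w : List ℕ) (βs : List (List ℕ)) : Set where
  field
    joins : join N βs ≡ w
    absent : Absent N βs
    pieces : length βs ≡ suc (occ N w)

splitOn-isSplit : ∀ N w → IsSplit N w (splitOn N w)
splitOn-isSplit N [] = record { joins = refl ; absent = (λ ()) ∷ [] ; pieces = refl }
splitOn-isSplit N (a ∷ w) with N ≡ᵇ a in e | splitOn N w | splitOn-isSplit N w
... | true | [] | record { pieces = () }
... | true | β ∷ βs | s = record
  { joins = cong₂ _∷_ (≡ᵇ-true⇒≡ N a e) (IsSplit.joins s)
  ; absent = (λ ()) ∷ IsSplit.absent s ; pieces = cong suc (trans (IsSplit.pieces s) (sym (occ-hit N a w e))) }
... | false | [] | record { pieces = () }
... | false | β ∷ [] | record { joins = j ; absent = β∌ ∷ [] ; pieces = p } = record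
  { joins = cong (a ∷_) j
  ; absent = (λ { (here q) → ≡ᵇ-false⇒≢ N a e q ; (there q) → β∌ q }) ∷ []
  ; pieces = trans p (cong suc (sym (occ-miss N a w e))) }
... | false | β ∷ β′ ∷ βs | record { joins = j ; absent = β∌ ∷ βs∌ ; pieces = p } = record
  { joins = cong (a ∷_) j
  ; absent = (λ { (here q) → ≡ᵇ-false⇒≢ N a e q ; (there q) → β∌ q }) ∷ βs∌
  ; pieces = trans p (cong suc (sym (occ-miss N a w e))) }

splitOn-absent : ∀ N β → N ∉ β → splitOn N β ≡ β ∷ []
splitOn-absent N [] _ = refl
splitOn-absent N (a ∷ β) N∉ with N ≡ᵇ a in e | splitOn N β | splitOn-absent N β (N∉ ∘ there)
... | true | _ | _ = contradiction (here (≡ᵇ-true⇒≡ N a e)) N∉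
... | false | _ | refl = refl

splitOn-++ : ∀ N β w → N ∉ β → splitOn N (β ++ N ∷ w) ≡ β ∷ splitOn N w
splitOn-++ N [] w _ with N ≡ᵇ N | ≡ᵇ-refl N
... | true | refl = refl
splitOn-++ N (a ∷ β) w N∉ with N ≡ᵇ a in e | splitOn N (β ++ N ∷ w) | splitOn-++ N β w (N∉ ∘ there)
... | true | _ | _ = contradiction (here (≡ᵇ-true⇒≡ N a e)) N∉
... | false | _ | refl = refl

splitOn-join : ∀ N β βs → Absent N (β ∷ βs) → splitOn N (join N (β ∷ βs)) ≡ β ∷ βs
splitOn-join N β [] (β∌ ∷ []) = splitOn-absent N β β∌
splitOn-join N β (β′ ∷ βs) (β∌ ∷ βs∌) = trans (splitOn-++ N β _ β∌) (cong (β ∷_) (splitOn-join N β′ βs βs∌))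

∈-join⁻ : ∀ N βs {x} → x ∈ join N βs → x ≡ N ⊎ x ∈ concat βs
∈-join⁻ N (β ∷ βs) = nonempty β βs
  where
  nonempty : ∀ β βs {x} → x ∈ join N (β ∷ βs) → x ≡ N ⊎ x ∈ concat (β ∷ βs)
  nonempty β [] x∈ = inj₂ (∈-++⁺ˡ x∈)
  nonempty β (β′ ∷ βs) x∈ with ∈-++⁻ β x∈
  ... | inj₁ x∈β = inj₂ (∈-++⁺ˡ x∈β)
  ... | inj₂ (here x≡N) = inj₁ x≡N
  ... | inj₂ (there x∈) with nonempty β′ βs x∈
  ... | inj₁ x≡N = inj₁ x≡N
  ... | inj₂ x∈βs = inj₂ (∈-++⁺ʳ β x∈βs)

∈-join⁺ : ∀ N βs {x} → x ∈ concat βs → x ∈ join N βs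
∈-join⁺ N (β ∷ βs) = nonempty β βs
  where
  nonempty : ∀ β βs {x} → x ∈ concat (β ∷ βs) → x ∈ join N (β ∷ βs)
  nonempty β [] x∈ = subst (_ ∈_) (List.++-identityʳ β) x∈
  nonempty β (β′ ∷ βs) x∈ with ∈-++⁻ β x∈
  ... | inj₁ x∈β = ∈-++⁺ˡ x∈β
  ... | inj₂ x∈βs = ∈-++⁺ʳ β (there (nonempty β′ βs x∈βs))

occ-join : ∀ N x βs → x ≢ N → occ x (join N βs) ≡ occ x (concat βs)
occ-join N x [] _ = refl
occ-join N x (β ∷ []) _ = cong (occ x) (sym (List.++-identityʳ β))
occ-join N x (β ∷ β′ ∷ βs) x≢N = begin
  occ x (β ++ N ∷ join N (β′ ∷ βs))         ≡⟨ occ-++ x β _ ⟩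
  occ x β + occ x (N ∷ join N (β′ ∷ βs))    ≡⟨ cong (λ t → occ x β + (if t then suc (occ x (join N (β′ ∷ βs))) else occ x (join N (β′ ∷ βs)))) (≢⇒≡ᵇ-false x N x≢N) ⟩
  occ x β + occ x (join N (β′ ∷ βs))        ≡⟨ cong (occ x β +_) (occ-join N x (β′ ∷ βs) x≢N) ⟩
  occ x β + occ x (concat (β′ ∷ βs))        ≡⟨ occ-++ x β _ ⟨
  occ x (concat (β ∷ β′ ∷ βs))              ∎
  where open ≡-Reasoning

-- Splitting the joined word returns the blocks, and their number exceeds the number of occurrences
-- of N by one.
occ-join-N : ∀ N β βs → Absent N (β ∷ βs) → occ N (join N (β ∷ βs)) ≡ length βs
occ-join-N N β βs abs = ℕ.suc-injective (trans (sym (IsSplit.pieces (splitOn-isSplit N (join N (β ∷ βs)))))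
  (cong length (splitOn-join N β βs abs)))

length-join : ∀ N β βs → length (join N (β ∷ βs)) ≡ length (concat (β ∷ βs)) + length βs
length-join N β [] = trans (cong length (sym (List.++-identityʳ β))) (sym (ℕ.+-identityʳ _))
length-join N β (β′ ∷ βs) = begin
  length (β ++ N ∷ join N (β′ ∷ βs))                          ≡⟨ List.length-++ β ⟩
  length β + suc (length (join N (β′ ∷ βs)))                  ≡⟨ cong (λ l → length β + suc l) (length-join N β′ βs) ⟩
  length β + suc (length (concat (β′ ∷ βs)) + length βs)      ≡⟨ cong (length β +_) (sym (ℕ.+-suc _ _)) ⟩
  length β + (length (concat (β′ ∷ βs)) + suc (length βs))    ≡⟨ ℕ.+-assoc (length β) _ _ ⟨
  length β + length (concat (β′ ∷ βs)) + suc (length βs)      ≡⟨ cong (_+ suc (length βs)) (List.length-++ β) ⟨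
  length (concat (β ∷ β′ ∷ βs)) + suc (length βs)             ∎
  where open ≡-Reasoning

-- The operator S

maxL-∈ : ∀ a w → maxL (a ∷ w) ∈ a ∷ w
maxL-∈ a [] = here (ℕ.⊔-identityʳ a)
maxL-∈ a (b ∷ w) with ℕ.⊔-sel a (maxL (b ∷ w))
... | inj₁ e = here e
... | inj₂ e = there (subst (_∈ b ∷ w) (sym e) (maxL-∈ b w))

maxL-≤ : ∀ w {x} → x ∈ w → x ≤ maxL w
maxL-≤ (a ∷ w) (here refl) = ℕ.m≤m⊔n a (maxL w)
maxL-≤ (a ∷ w) (there x∈) = ℕ.≤-trans (maxL-≤ w x∈) (ℕ.m≤n⊔m a (maxL w))

maxL-unique : ∀ w {N} → N ∈ w → (∀ {x} → x ∈ w → x ≤ N) → maxL w ≡ N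
maxL-unique (a ∷ w) N∈ bound = ℕ.≤-antisym (bound (maxL-∈ a w)) (maxL-≤ (a ∷ w) N∈)

length-concat-∈ : ∀ {A : Set} {β : List A} {βs} → β ∈ βs → length β ≤ length (concat βs)
length-concat-∈ {β = β} (here refl) = ℕ.≤-trans (ℕ.m≤m+n (length β) _) (ℕ.≤-reflexive (sym (List.length-++ β)))
length-concat-∈ {βs = γ ∷ βs} (there β∈) = ℕ.≤-trans (length-concat-∈ β∈)
  (ℕ.≤-trans (ℕ.m≤n+m _ (length γ)) (ℕ.≤-reflexive (sym (List.length-++ γ))))

occ-∈ : ∀ {x w} → x ∈ w → 0 < occ x w
occ-∈ {x} {a ∷ w} (here refl) rewrite ≡ᵇ-refl x = s≤s z≤n
occ-∈ {x} {a ∷ w} (there x∈) with x ≡ᵇ a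
... | true = s≤s z≤n
... | false = occ-∈ x∈

-- The length of the word is the total length of the blocks plus the number of copies of N, which is
-- positive.
split-shorter : ∀ N w {β} → N ∈ w → β ∈ splitOn N w → length β < length w
split-shorter N w {β} N∈ β∈ = shorter (splitOn N w) (splitOn-isSplit N w) β∈
  where
  shorter : ∀ βs → IsSplit N w βs → β ∈ βs → length β < length w
  shorter (γ ∷ βs) s β∈ = ℕ.<-≤-trans
    (ℕ.≤-<-trans (length-concat-∈ β∈) (ℕ.m<m+n _ (subst (0 <_) (sym (ℕ.suc-injective (IsSplit.pieces s))) (occ-∈ N∈))))
    (ℕ.≤-reflexive (trans (sym (length-join N γ βs)) (cong length (IsSplit.joins s))))

map-cong-∈ : ∀ {A B : Set} {f g : A → B} xs → (∀ {x} → x ∈ xs → f x ≡ g x) → map f xs ≡ map g xs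
map-cong-∈ [] e = refl
map-cong-∈ (x ∷ xs) e = cong₂ _∷_ (e (here refl)) (map-cong-∈ xs (e ∘ there))

stackF-fuel : ∀ f g w → length w < f → length w < g → stackF f w ≡ stackF g w
stackF-fuel (suc f) (suc g) [] _ _ = refl
stackF-fuel (suc f) (suc g) (a ∷ w) (s≤s p) (s≤s q) = cong (λ ws → concat ws ++ [ maxL (a ∷ w) ])
  (map-cong-∈ (splitOn (maxL (a ∷ w)) (a ∷ w)) (λ {β} β∈ →
    let short = split-shorter _ (a ∷ w) (maxL-∈ a w) β∈ in
    stackF-fuel f g β (ℕ.<-≤-trans short p) (ℕ.<-≤-trans short q)))

-- Inside `stackF` each block runs on fuel derived from the whole word; `stackF-fuel` exchanges it
-- for the fuel that `S` gives to the block itself.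
S-unfold : ∀ w {N} → N ∈ w → (∀ {x} → x ∈ w → x ≤ N) → S w ≡ concat (map S (splitOn N w)) ++ [ N ]
S-unfold (a ∷ w) {N} N∈ bound with maxL (a ∷ w) | maxL-unique (a ∷ w) N∈ bound
... | _ | refl = cong (λ ws → concat ws ++ [ N ])
  (map-cong-∈ (splitOn N (a ∷ w)) (λ {β} β∈ →
    stackF-fuel (suc (length w)) (suc (length β)) β (split-shorter N (a ∷ w) N∈ β∈) ℕ.≤-refl))

-- Only membership can be preserved: `S` merges the copies of a largest letter into one, so
-- multiplicities are lost.
∈-S : ∀ w → (∀ {x} → x ∈ S w → x ∈ w) × (∀ {x} → x ∈ w → x ∈ S w)
∈-S w = <-rec P step (length w) w refl
  where
  P : ℕ → Set
  P l = ∀ w → length w ≡ l → (∀ {x} → x ∈ S w → x ∈ w) × (∀ {x} → x ∈ w → x ∈ S w)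

  pieces⁻ : ∀ βs → (∀ {β} → β ∈ βs → ∀ {x} → x ∈ S β → x ∈ β) → ∀ {x} → x ∈ concat (map S βs) → x ∈ concat βs
  pieces⁻ (β ∷ βs) h x∈ with ∈-++⁻ (S β) x∈
  ... | inj₁ x∈ = ∈-++⁺ˡ (h (here refl) x∈)
  ... | inj₂ x∈ = ∈-++⁺ʳ β (pieces⁻ βs (h ∘ there) x∈)

  pieces⁺ : ∀ βs → (∀ {β} → β ∈ βs → ∀ {x} → x ∈ β → x ∈ S β) → ∀ {x} → x ∈ concat βs → x ∈ concat (map S βs)
  pieces⁺ (β ∷ βs) h x∈ with ∈-++⁻ β x∈
  ... | inj₁ x∈ = ∈-++⁺ˡ (h (here refl) x∈)
  ... | inj₂ x∈ = ∈-++⁺ʳ (S β) (pieces⁺ βs (h ∘ there) x∈)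

  step : ∀ l → (∀ {m} → m < l → P m) → P l
  step l IH [] _ = id , id
  step .(suc (length w)) IH (a ∷ w) refl = to , from
    where
    N : ℕ
    N = maxL (a ∷ w)
    βs : List (List ℕ)
    βs = splitOn N (a ∷ w)
    unfold : S (a ∷ w) ≡ concat (map S βs) ++ [ N ]
    unfold = S-unfold (a ∷ w) (maxL-∈ a w) (maxL-≤ (a ∷ w))
    joins : join N βs ≡ a ∷ w
    joins = IsSplit.joins (splitOn-isSplit N (a ∷ w))
    piece : ∀ {β} → β ∈ βs → (∀ {x} → x ∈ S β → x ∈ β) × (∀ {x} → x ∈ β → x ∈ S β)
    piece {β} β∈ = IH (split-shorter N (a ∷ w) (maxL-∈ a w) β∈) β refl
    to : ∀ {x} → x ∈ S (a ∷ w) → x ∈ a ∷ w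
    to x∈ with ∈-++⁻ (concat (map S βs)) (subst (_ ∈_) unfold x∈)
    ... | inj₁ x∈ = subst (_ ∈_) joins (∈-join⁺ N βs (pieces⁻ βs (λ β∈ → proj₁ (piece β∈)) x∈))
    ... | inj₂ (here refl) = maxL-∈ a w
    from : ∀ {x} → x ∈ a ∷ w → x ∈ S (a ∷ w)
    from x∈ with ∈-join⁻ N βs (subst (_ ∈_) (sym joins) x∈)
    ... | inj₁ x≡N = subst (_ ∈_) (sym unfold) (∈-++⁺ʳ (concat (map S βs)) (here x≡N))
    ... | inj₂ x∈ = subst (_ ∈_) (sym unfold) (∈-++⁺ˡ (pieces⁺ βs (λ β∈ → proj₂ (piece β∈)) x∈))

sortAll : List (List ℕ) → List ℕ
sortAll αs = concat (map S αs)

∈-sortAll⁻ : ∀ αs {x} → x ∈ sortAll αs → x ∈ concat αs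
∈-sortAll⁻ (α ∷ αs) x∈ with ∈-++⁻ (S α) x∈
... | inj₁ x∈ = ∈-++⁺ˡ (proj₁ (∈-S α) x∈)
... | inj₂ x∈ = ∈-++⁺ʳ α (∈-sortAll⁻ αs x∈)

∈-sortAll⁺ : ∀ αs {x} → x ∈ concat αs → x ∈ sortAll αs
∈-sortAll⁺ (α ∷ αs) x∈ with ∈-++⁻ α x∈
... | inj₁ x∈ = ∈-++⁺ˡ (proj₂ (∈-S α) x∈)
... | inj₂ x∈ = ∈-++⁺ʳ (S α) (∈-sortAll⁺ αs x∈)

sortAll-++ : ∀ us vs → sortAll (us ++ vs) ≡ sortAll us ++ sortAll vs
sortAll-++ us vs = trans (cong concat (List.map-++ S us vs)) (concat-++ (map S us) (map S vs))

-- Decomposition at the largest letter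

⊆-++⁻ : ∀ {A : Set} {p : List A} u {v} → p ⊆ u ++ v → ∃[ p₁ ] ∃[ p₂ ] p ≡ p₁ ++ p₂ × p₁ ⊆ u × p₂ ⊆ v
⊆-++⁻ [] τ = [] , _ , refl , [] , τ
⊆-++⁻ (a ∷ u) (.a ∷ʳ τ) with ⊆-++⁻ u τ
... | p₁ , p₂ , e , τ₁ , τ₂ = p₁ , p₂ , e , a ∷ʳ τ₁ , τ₂
⊆-++⁻ (a ∷ u) (refl ∷ τ) with ⊆-++⁻ u τ
... | p₁ , p₂ , e , τ₁ , τ₂ = a ∷ p₁ , p₂ , cong (a ∷_) e , refl ∷ τ₁ , τ₂

Disj : List (List ℕ) → Set
Disj [] = ⊤
Disj (α ∷ αs) = (∀ {x} → x ∈ α → x ∉ concat αs) × Disj αs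

Disj-++⁺ : ∀ us {vs} → Disj us → Disj vs → (∀ {x} → x ∈ concat us → x ∉ concat vs) → Disj (us ++ vs)
Disj-++⁺ [] _ dv _ = dv
Disj-++⁺ (u ∷ us) {vs} (du , dus) dv h =
  (λ x∈u x∈ → [ du x∈u , h (∈-++⁺ˡ x∈u) ]′ (∈-++⁻ (concat us) (subst (_ ∈_) (concat-++ us vs) x∈)))
  , Disj-++⁺ us dus dv (h ∘ ∈-++⁺ʳ u)

Disj-++⁻ : ∀ us {vs} → Disj (us ++ vs) → Disj us × Disj vs × (∀ {x} → x ∈ concat us → x ∉ concat vs)
Disj-++⁻ [] dv = tt , dv , λ ()
Disj-++⁻ (u ∷ us) {vs} (du , d) with Disj-++⁻ us d
... | dus , dv , h = ((λ x∈u x∈ → du x∈u (subst (_ ∈_) (sym (concat-++ us vs)) (∈-++⁺ˡ x∈))) , dus) , dv ,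
  λ x∈ x∈v → [ (λ x∈u → du x∈u (subst (_ ∈_) (sym (concat-++ us vs)) (∈-++⁺ʳ (concat us) x∈v))) , (λ x∈us → h x∈us x∈v) ]′ (∈-++⁻ u x∈)

-- The condition on index triples in subsequence form, which passes to subwords by transitivity of
-- `⊆`.
Nest : List ℕ → Set
Nest w = ∀ {a b} → a ∷ b ∷ a ∷ [] ⊆ w → b ≤ a

concat-⊆-join : ∀ N βs → concat βs ⊆ join N βs
concat-⊆-join N [] = []
concat-⊆-join N (β ∷ βs) = nonempty β βs
  where
  nonempty : ∀ β βs → concat (β ∷ βs) ⊆ join N (β ∷ βs)
  nonempty β [] = subst (_⊆ β) (sym (List.++-identityʳ β)) ⊆-refl
  nonempty β (β′ ∷ βs) = ++⁺ (⊆-refl {x = β}) (N ∷ʳ nonempty β′ βs)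

⊆-join⁻ : ∀ N βs {p} → N ∉ p → p ⊆ join N βs → p ⊆ concat βs
⊆-join⁻ N [] _ τ = τ
⊆-join⁻ N (β ∷ βs) = nonempty β βs
  where
  nonempty : ∀ β βs {p} → N ∉ p → p ⊆ join N (β ∷ βs) → p ⊆ concat (β ∷ βs)
  nonempty β [] _ τ = ++⁺ʳ [] τ
  nonempty β (β′ ∷ βs) N∉ τ with ⊆-++⁻ β τ
  ... | p₁ , p₂ , refl , τ₁ , (.N ∷ʳ τ₂) = ++⁺ τ₁ (nonempty β′ βs (N∉ ∘ ∈-++⁺ʳ p₁) τ₂)
  ... | p₁ , .(N ∷ _) , refl , τ₁ , (refl ∷ τ₂) = contradiction (∈-++⁺ʳ p₁ (here refl)) N∉

-- A letter on both sides of a separator N would occur in two blocks.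
join-separates : ∀ N βs {a} → Absent N βs → a ≢ N → Disj βs → a ∷ N ∷ a ∷ [] ⊆ join N βs → ⊥
join-separates N (β ∷ βs) = nonempty β βs
  where
  nonempty : ∀ β βs {a} → Absent N (β ∷ βs) → a ≢ N → Disj (β ∷ βs) → a ∷ N ∷ a ∷ [] ⊆ join N (β ∷ βs) → ⊥
  nonempty β [] (N∉β ∷ []) _ _ τ = N∉β (lookup τ (there (here refl)))
  nonempty β (β′ ∷ βs) {a} (N∉β ∷ N∉βs) a≢N (dβ , d) τ with ⊆-++⁻ β τ
  ... | [] , _ , refl , τ₁ , (.N ∷ʳ τ₂) = nonempty β′ βs N∉βs a≢N d τ₂
  ... | [] , _ , refl , τ₁ , (a≡N ∷ τ₂) = a≢N a≡N
  ... | _ ∷ [] , _ , refl , τ₁ , τ₂ with lookup τ₂ (there (here refl))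
  ...   | here a≡N = a≢N a≡N
  ...   | there a∈ = [ a≢N , dβ (to∈ τ₁) ]′ (∈-join⁻ N (β′ ∷ βs) a∈)
  nonempty β (β′ ∷ βs) (N∉β ∷ N∉βs) a≢N (dβ , d) τ | _ ∷ _ ∷ [] , _ , refl , τ₁ , τ₂ = N∉β (lookup τ₁ (there (here refl)))
  nonempty β (β′ ∷ βs) (N∉β ∷ N∉βs) a≢N (dβ , d) τ | _ ∷ _ ∷ _ ∷ [] , _ , refl , τ₁ , τ₂ = N∉β (lookup τ₁ (there (here refl)))

-- Between two blocks there is a copy of N, so a common letter a would give a N a with a < N. This
-- makes the blocks admissible as separate components of the smaller tuple.
Nest-join⇒Disj : ∀ N βs → (∀ {x} → x ∈ concat βs → x < N) → Nest (join N βs) → Disj βs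
Nest-join⇒Disj N [] _ _ = tt
Nest-join⇒Disj N (β ∷ βs) = nonempty β βs
  where
  nonempty : ∀ β βs → (∀ {x} → x ∈ concat (β ∷ βs) → x < N) → Nest (join N (β ∷ βs)) → Disj (β ∷ βs)
  nonempty β [] _ _ = (λ _ ()) , tt
  nonempty β (β′ ∷ βs) bound nest =
    (λ x∈β x∈βs → ℕ.<⇒≱ (bound (∈-++⁺ˡ x∈β))
      (nest (++⁺ (from∈ x∈β) (refl ∷ from∈ (∈-join⁺ N (β′ ∷ βs) x∈βs)))))
    , nonempty β′ βs (bound ∘ ∈-++⁺ʳ β) (λ τ → nest (++⁺ˡ β (N ∷ʳ τ)))

concat-insert : ∀ {A : Set} (us : List (List A)) v vs → concat (us ++ v ∷ vs) ≡ concat us ++ v ++ concat vs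
concat-insert us v vs = concat-++ us (v ∷ vs)

-- Common ground of `compose` and `decompose`: all that is known is that N exceeds the other
-- letters. Two blocks are required for N to occur in the joined word, and 1 ≤ r provides them.
module Glue (N : ℕ) (pre βs post : List (List ℕ))
  (pieces : 2 ≤ length βs)
  (left< : ∀ {x} → x ∈ concat (pre ++ βs) → x < N)
  (right< : ∀ {x} → x ∈ concat post → x < N)
  where

  pre< : ∀ {x} → x ∈ concat pre → x < N
  pre< x∈ = left< (subst (_ ∈_) (sym (concat-++ pre βs)) (∈-++⁺ˡ x∈))

  βs< : ∀ {x} → x ∈ concat βs → x < N
  βs< x∈ = left< (subst (_ ∈_) (sym (concat-++ pre βs)) (∈-++⁺ʳ (concat pre) x∈))

  absent : Absent N βs
  absent = absent-concat βs (ℕ.<-irrefl refl ∘ βs<)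

  N∈join : ∀ βs → 2 ≤ length βs → N ∈ join N βs
  N∈join (β ∷ []) (s≤s ())
  N∈join (β ∷ β′ ∷ βs) _ = ∈-++⁺ʳ β (here refl)

  splitOn-join′ : ∀ βs → 2 ≤ length βs → Absent N βs → splitOn N (join N βs) ≡ βs
  splitOn-join′ (β ∷ βs) _ = splitOn-join N β βs

  S-join : S (join N βs) ≡ sortAll βs ++ [ N ]
  S-join = trans
    (S-unfold (join N βs) (N∈join βs pieces)
      (λ x∈ → [ ℕ.≤-reflexive , ℕ.<⇒≤ ∘ βs< ]′ (∈-join⁻ N βs x∈)))
    (cong (λ ws → sortAll ws ++ [ N ]) (splitOn-join′ βs pieces absent))

  sortAll-glue : sortAll (pre ++ join N βs ∷ post) ≡ sortAll (pre ++ βs) ++ N ∷ sortAll post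
  sortAll-glue = begin
    sortAll (pre ++ join N βs ∷ post)                        ≡⟨ sortAll-++ pre (join N βs ∷ post) ⟩
    sortAll pre ++ S (join N βs) ++ sortAll post             ≡⟨ cong (λ w → sortAll pre ++ w ++ sortAll post) S-join ⟩
    sortAll pre ++ (sortAll βs ++ [ N ]) ++ sortAll post     ≡⟨ cong (sortAll pre ++_) (List.++-assoc (sortAll βs) [ N ] (sortAll post)) ⟩
    sortAll pre ++ sortAll βs ++ N ∷ sortAll post            ≡⟨ List.++-assoc (sortAll pre) (sortAll βs) (N ∷ sortAll post) ⟨
    (sortAll pre ++ sortAll βs) ++ N ∷ sortAll post          ≡⟨ cong (_++ N ∷ sortAll post) (sortAll-++ pre βs) ⟨
    sortAll (pre ++ βs) ++ N ∷ sortAll post                  ∎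
    where open ≡-Reasoning

  sortAll-left< : ∀ {x} → x ∈ sortAll (pre ++ βs) → x < N
  sortAll-left< = left< ∘ ∈-sortAll⁻ (pre ++ βs)

  sortAll-right< : ∀ {x} → x ∈ sortAll post → x < N
  sortAll-right< = right< ∘ ∈-sortAll⁻ post

  -- The first pass leaves N at the end of its component, so the second pass sees uNv and treats u
  -- and v independently.
  sort-glue : S (sortAll (pre ++ join N βs ∷ post)) ≡ (S (sortAll (pre ++ βs)) ++ S (sortAll post)) ++ [ N ]
  sort-glue = begin
    S (sortAll (pre ++ join N βs ∷ post))         ≡⟨ cong S sortAll-glue ⟩
    S (u ++ N ∷ v)                                ≡⟨ S-unfold (u ++ N ∷ v) (∈-++⁺ʳ u (here refl)) bound ⟩
    sortAll (splitOn N (u ++ N ∷ v)) ++ [ N ]     ≡⟨ cong (λ ws → sortAll ws ++ [ N ]) (trans (splitOn-++ N u v (ℕ.<-irrefl refl ∘ sortAll-left<))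
                                                      (cong (u ∷_) (splitOn-absent N v (ℕ.<-irrefl refl ∘ sortAll-right<)))) ⟩
    (S u ++ S v ++ []) ++ [ N ]                   ≡⟨ cong (λ w → (S u ++ w) ++ [ N ]) (List.++-identityʳ (S v)) ⟩
    (S u ++ S v) ++ [ N ]                         ∎
    where
    open ≡-Reasoning
    u v : List ℕ
    u = sortAll (pre ++ βs)
    v = sortAll post
    bound : ∀ {x} → x ∈ u ++ N ∷ v → x ≤ N
    bound x∈ with ∈-++⁻ u x∈
    ... | inj₁ x∈u = ℕ.<⇒≤ (sortAll-left< x∈u)
    ... | inj₂ (here refl) = ℕ.≤-refl
    ... | inj₂ (there x∈v) = ℕ.<⇒≤ (sortAll-right< x∈v)

  occ-glue : ∀ x → x ≢ N → occ x (concat (pre ++ join N βs ∷ post)) ≡ occ x (concat (pre ++ βs)) + occ x (concat post)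
  occ-glue x x≢N = begin
    occ x (concat (pre ++ join N βs ∷ post))                      ≡⟨ cong (occ x) (concat-insert pre (join N βs) post) ⟩
    occ x (concat pre ++ join N βs ++ concat post)                ≡⟨ occ-++ x (concat pre) _ ⟩
    occ x (concat pre) + occ x (join N βs ++ concat post)         ≡⟨ cong (occ x (concat pre) +_) (occ-++ x (join N βs) (concat post)) ⟩
    occ x (concat pre) + (occ x (join N βs) + occ x (concat post)) ≡⟨ cong (λ o → occ x (concat pre) + (o + occ x (concat post))) (occ-join N x βs x≢N) ⟩
    occ x (concat pre) + (occ x (concat βs) + occ x (concat post)) ≡⟨ ℕ.+-assoc (occ x (concat pre)) _ _ ⟨
    occ x (concat pre) + occ x (concat βs) + occ x (concat post)   ≡⟨ cong (_+ occ x (concat post)) (occ-++ x (concat pre) (concat βs)) ⟨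
    occ x (concat pre ++ concat βs) + occ x (concat post)          ≡⟨ cong (λ w → occ x w + occ x (concat post)) (concat-++ pre βs) ⟨
    occ x (concat (pre ++ βs)) + occ x (concat post)               ∎
    where open ≡-Reasoning

-- No field confines the letters to the interval: `sorted` already does, because `S` preserves the
-- set of letters. This is how `letters` is obtained.
record Valid (r off n : ℕ) (αs : List (List ℕ)) : Set where
  field
    occurrences : ∀ {x} → off < x → x ≤ off + n → occ x (concat αs) ≡ r
    nest : Nest (concat αs)
    disj : Disj αs
    sorted : S (sortAll αs) ≡ range off n

  letters : ∀ {x} → x ∈ concat αs → off < x × x ≤ off + n
  letters x∈ = ∈-range⁻ (subst (_ ∈_) sorted (proj₂ (∈-S (sortAll αs)) (∈-sortAll⁺ αs x∈)))

  letters⁻ : ∀ {x} → off < x → x ≤ off + n → x ∈ concat αs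
  letters⁻ p q = ∈-sortAll⁻ αs (proj₁ (∈-S (sortAll αs)) (subst (_ ∈_) (sym sorted) (∈-range⁺ p q)))

compose : ∀ {r off m l} pre βs post → 1 ≤ r → length βs ≡ suc r →
  Valid r off m (pre ++ βs) → Valid r (off + m) l post →
  Valid r off (suc (m + l)) (pre ++ join (off + suc (m + l)) βs ∷ post)
compose {r} {off} {m} {l} pre βs post 1≤r |βs| VA VB = record
  { occurrences = occurrences
  ; nest = nest
  ; disj = Disj-++⁺ pre dpre
      ((λ x∈ x∈post → [ (λ { refl → N∉post x∈post }) , (λ x∈βs → left∉post (∈-++ʳ x∈βs) x∈post) ]′ (∈-join⁻ N βs x∈)) , VB.disj)
      (λ {x} x∈pre x∈ → [ (λ x∈join → [ (λ { refl → N∉pre x∈pre }) , pre∉βs x∈pre ]′ (∈-join⁻ N βs x∈join))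
                    , left∉post (∈-++ˡ x∈pre) ]′ (∈-++⁻ (join N βs) x∈))
  ; sorted = trans sort-glue (trans (cong (_++ [ N ])
      (trans (cong₂ _++_ VA.sorted VB.sorted) (sym (range-++ off m l)))) (sym (range-snoc off (m + l))))
  }
  where
  module VA = Valid VA
  module VB = Valid VB
  N : ℕ
  N = off + suc (m + l)

  off+m<N : off + m < N
  off+m<N = ℕ.+-monoʳ-< off (s≤s (ℕ.m≤m+n m l))

  off+m+l<N : off + m + l < N
  off+m+l<N = ℕ.≤-reflexive (trans (cong suc (ℕ.+-assoc off m l)) (sym (ℕ.+-suc off (m + l))))

  open Glue N pre βs post (subst (2 ≤_) (sym |βs|) (s≤s 1≤r))
    (λ x∈ → ℕ.≤-<-trans (proj₂ (VA.letters x∈)) off+m<N)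
    (λ x∈ → ℕ.≤-<-trans (proj₂ (VB.letters x∈)) off+m+l<N)

  ∈-++ˡ : ∀ {x} → x ∈ concat pre → x ∈ concat (pre ++ βs)
  ∈-++ˡ x∈ = subst (_ ∈_) (sym (concat-++ pre βs)) (∈-++⁺ˡ x∈)

  ∈-++ʳ : ∀ {x} → x ∈ concat βs → x ∈ concat (pre ++ βs)
  ∈-++ʳ x∈ = subst (_ ∈_) (sym (concat-++ pre βs)) (∈-++⁺ʳ (concat pre) x∈)

  N∉pre : N ∉ concat pre
  N∉pre N∈ = ℕ.<-irrefl refl (pre< N∈)

  N∉post : N ∉ concat post
  N∉post N∈ = ℕ.<⇒≱ off+m+l<N (proj₂ (VB.letters N∈))

  left∉post : ∀ {x} → x ∈ concat (pre ++ βs) → x ∉ concat post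
  left∉post x∈ x∈post = ℕ.<⇒≱ (proj₁ (VB.letters x∈post)) (proj₂ (VA.letters x∈))

  dpre : Disj pre
  dpre = proj₁ (Disj-++⁻ pre VA.disj)

  dβs : Disj βs
  dβs = proj₁ (proj₂ (Disj-++⁻ pre VA.disj))

  pre∉βs : ∀ {x} → x ∈ concat pre → x ∉ concat βs
  pre∉βs = proj₂ (proj₂ (Disj-++⁻ pre VA.disj))

  occ-N : ∀ βs → length βs ≡ suc r → Absent N βs → occ N (join N βs) ≡ r
  occ-N (β ∷ βs) e abs = trans (occ-join-N N β βs abs) (ℕ.suc-injective e)

  occurrences : ∀ {x} → off < x → x ≤ N → occ x (concat (pre ++ join N βs ∷ post)) ≡ r
  occurrences {x} off<x x≤N with x ℕ.≟ N
  ... | yes refl = begin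
    occ N (concat (pre ++ join N βs ∷ post))           ≡⟨ cong (occ N) (concat-insert pre (join N βs) post) ⟩
    occ N (concat pre ++ join N βs ++ concat post)     ≡⟨ occ-++ N (concat pre) _ ⟩
    occ N (concat pre) + occ N (join N βs ++ concat post)
      ≡⟨ cong₂ _+_ (occ-∉ (concat pre) N∉pre) (trans (occ-++ N (join N βs) (concat post))
           (cong₂ _+_ (occ-N βs |βs| absent) (occ-∉ (concat post) N∉post))) ⟩
    r + 0                                              ≡⟨ ℕ.+-identityʳ r ⟩
    r                                                  ∎
    where open ≡-Reasoning
  ... | no x≢N with x ℕ.≤? off + m
  ...   | yes x≤ = trans (occ-glue x x≢N) (trans (cong₂ _+_ (VA.occurrences off<x x≤)
            (occ-∉ (concat post) (λ x∈ → ℕ.<⇒≱ (proj₁ (VB.letters x∈)) x≤))) (ℕ.+-identityʳ r))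
  ...   | no x≰ = trans (occ-glue x x≢N) (cong₂ _+_
            (occ-∉ (concat (pre ++ βs)) (x≰ ∘ proj₂ ∘ VA.letters))
            (VB.occurrences (ℕ.≰⇒> x≰) (ℕ.≤-pred (ℕ.≤-trans (ℕ.≤∧≢⇒< x≤N x≢N)
              (ℕ.≤-reflexive (trans (ℕ.+-suc off (m + l)) (cong suc (sym (ℕ.+-assoc off m l)))))))))

  -- If b differs from N, deleting the copies of N leaves the pattern in the left tuple. If b = N,
  -- then a occurs on both sides of a copy of N, hence in two components of the left tuple, against
  -- their disjointness.
  left-nest : ∀ {a b} → a ≢ N → a ∷ b ∷ a ∷ [] ⊆ concat pre ++ join N βs → b ≤ a
  left-nest {a} {b} a≢N τ with b ℕ.≟ N | ⊆-++⁻ (concat pre) τ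
  ... | no b≢N | p₁ , p₂ , e , τ₁ , τ₂ = VA.nest (subst (_⊆ concat (pre ++ βs)) (sym e)
          (subst (p₁ ++ p₂ ⊆_) (sym (concat-++ pre βs)) (++⁺ τ₁ (⊆-join⁻ N βs N∉p₂ τ₂))))
    where
    N∉aba : N ∉ a ∷ b ∷ a ∷ []
    N∉aba (here e) = a≢N (sym e)
    N∉aba (there (here e)) = b≢N (sym e)
    N∉aba (there (there (here e))) = a≢N (sym e)
    N∉p₂ : N ∉ p₂
    N∉p₂ N∈ = N∉aba (subst (N ∈_) (sym e) (∈-++⁺ʳ p₁ N∈))
  ... | yes refl | [] , _ , refl , τ₁ , τ₂ = ⊥-elim (join-separates N βs absent a≢N dβs τ₂)
  ... | yes refl | _ ∷ [] , _ , refl , τ₁ , τ₂ = ⊥-elim ([ a≢N , pre∉βs (to∈ τ₁) ]′ (∈-join⁻ N βs (lookup τ₂ (there (here refl)))))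
  ... | yes refl | _ ∷ _ ∷ [] , _ , refl , τ₁ , τ₂ = ⊥-elim (N∉pre (lookup τ₁ (there (here refl))))
  ... | yes refl | _ ∷ _ ∷ _ ∷ [] , _ , refl , τ₁ , τ₂ = ⊥-elim (N∉pre (lookup τ₁ (there (here refl))))

  ≤N : ∀ {x} → x ∈ concat pre ++ join N βs ++ concat post → x ≤ N
  ≤N x∈ with ∈-++⁻ (concat pre) x∈
  ... | inj₁ x∈pre = ℕ.<⇒≤ (pre< x∈pre)
  ... | inj₂ x∈ with ∈-++⁻ (join N βs) x∈
  ... | inj₁ x∈join = [ ℕ.≤-reflexive , ℕ.<⇒≤ ∘ βs< ]′ (∈-join⁻ N βs x∈join)
  ... | inj₂ x∈post = ℕ.≤-trans (proj₂ (VB.letters x∈post)) (ℕ.<⇒≤ off+m+l<N)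

  restrictˡ : ∀ {a b} → a ∉ concat post → a ∷ b ∷ a ∷ [] ⊆ (concat pre ++ join N βs) ++ concat post →
    a ∷ b ∷ a ∷ [] ⊆ concat pre ++ join N βs
  restrictˡ a∉ τ with ⊆-++⁻ (concat pre ++ join N βs) τ
  ... | _ ∷ _ ∷ _ ∷ [] , _ , refl , τ₁ , _ = τ₁
  ... | [] , _ , refl , _ , τ₂ = contradiction (lookup τ₂ (here refl)) a∉
  ... | _ ∷ [] , _ , refl , _ , τ₂ = contradiction (lookup τ₂ (there (here refl))) a∉
  ... | _ ∷ _ ∷ [] , _ , refl , _ , τ₂ = contradiction (lookup τ₂ (here refl)) a∉

  restrictʳ : ∀ {a b} → a ∉ concat pre ++ join N βs → a ∷ b ∷ a ∷ [] ⊆ (concat pre ++ join N βs) ++ concat post →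
    a ∷ b ∷ a ∷ [] ⊆ concat post
  restrictʳ a∉ τ with ⊆-++⁻ (concat pre ++ join N βs) τ
  ... | [] , _ , refl , _ , τ₂ = τ₂
  ... | a ∷ _ , _ , e , τ₁ , _ = contradiction (subst (_∈ concat pre ++ join N βs) (sym (List.∷-injectiveˡ e)) (lookup τ₁ (here refl))) a∉

  nest : Nest (concat (pre ++ join N βs ∷ post))
  -- A letter a other than N belongs to the lower or the upper interval, so both its copies, and
  -- with them the whole pattern, lie in the corresponding part of the word.
  nest {a} {b} τ with a ℕ.≟ N | a ℕ.≤? off + m
  ... | yes a≡N | _ = subst (b ≤_) (sym a≡N) (≤N (subst (b ∈_) (concat-insert pre (join N βs) post) (lookup τ (there (here refl)))))
  ... | no a≢N | yes a≤ = left-nest a≢N (restrictˡ (λ a∈ → ℕ.<⇒≱ (proj₁ (VB.letters a∈)) a≤) τ′)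
    where
    τ′ : a ∷ b ∷ a ∷ [] ⊆ (concat pre ++ join N βs) ++ concat post
    τ′ = subst (_ ⊆_) (trans (concat-insert pre (join N βs) post) (sym (List.++-assoc (concat pre) _ _))) τ
  ... | no a≢N | no a≰ = VB.nest (restrictʳ a∉ τ′)
    where
    τ′ : a ∷ b ∷ a ∷ [] ⊆ (concat pre ++ join N βs) ++ concat post
    τ′ = subst (_ ⊆_) (trans (concat-insert pre (join N βs) post) (sym (List.++-assoc (concat pre) _ _))) τ
    a∉ : a ∉ concat pre ++ join N βs
    a∉ a∈ with ∈-++⁻ (concat pre) a∈
    ... | inj₁ a∈pre = a≰ (proj₂ (VA.letters (∈-++ˡ a∈pre)))
    ... | inj₂ a∈join = [ a≢N , (λ a∈βs → a≰ (proj₂ (VA.letters (∈-++ʳ a∈βs)))) ]′ (∈-join⁻ N βs a∈join)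

record Decomposition (r off n : ℕ) (αs : List (List ℕ)) : Set where
  field
    {m l} : ℕ
    pre βs post : List (List ℕ)
    sizes : m + l ≡ n
    glued : αs ≡ pre ++ join (off + suc n) βs ∷ post
    |βs| : length βs ≡ suc r
    left : Valid r off m (pre ++ βs)
    right : Valid r (off + m) l post

decompose : ∀ {r off n αs} → 1 ≤ r → Valid r off (suc n) αs → Decomposition r off n αs
decompose {r} {off} {n} {αs} 1≤r V with ∈-concat⁻′ αs (Valid.letters⁻ V {off + suc n} (ℕ.m<m+n off (s≤s z≤n)) ℕ.≤-refl)
... | α , N∈α , α∈αs with ∈-∃++ α∈αs
... | pre , post , refl = record
  { pre = pre ; βs = βs ; post = post
  ; sizes = size
  ; glued = cong (λ w → pre ++ w ∷ post) (sym joins)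
  ; |βs| = |βs|
  ; left = record
    { occurrences = λ {x} off<x x≤ →
        trans (sym (trans (occ-all (ℕ.<⇒≢ (x<N (∈-range⁺ off<x x≤))))
                (trans (cong (occ x (concat (pre ++ βs)) +_) (occ-∉ (concat post) (λ x∈ → ℕ.<⇒≱ (proj₁ (right-range x∈)) x≤)))
                  (ℕ.+-identityʳ _))))
          (V.occurrences off<x (ℕ.<⇒≤ (x<N (∈-range⁺ off<x x≤))))
    ; nest = λ τ → V.nest (⊆-trans τ left⊆)
    ; disj = Disj-++⁺ pre dpre dβs (λ x∈ x∈βs → pre∉ x∈ (∈-++⁺ˡ (βs⊆α x∈βs)))
    ; sorted = left-sorted
    }
  ; right = record
    { occurrences = λ {x} <x x≤ →
        trans (sym (trans (occ-all (ℕ.<⇒≢ (right<N x≤)))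
                (cong (_+ occ x (concat post)) (occ-∉ (concat (pre ++ βs)) (λ x∈ → ℕ.<⇒≱ <x (proj₂ (left-range x∈)))))))
          (V.occurrences (ℕ.≤-<-trans (ℕ.m≤m+n off m) <x) (ℕ.<⇒≤ (right<N x≤)))
    ; nest = λ τ → V.nest (⊆-trans τ right⊆)
    ; disj = dpost
    ; sorted = right-sorted
    }
  }
  where
  module V = Valid V
  N : ℕ
  N = off + suc n
  βs : List (List ℕ)
  βs = splitOn N α
  open IsSplit (splitOn-isSplit N α) renaming (absent to βs-absent; pieces to βs-pieces)

  dpre : Disj pre
  dpre = proj₁ (Disj-++⁻ pre V.disj)
  α∉post : ∀ {x} → x ∈ α → x ∉ concat post
  α∉post = proj₁ (proj₁ (proj₂ (Disj-++⁻ pre V.disj)))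
  dpost : Disj post
  dpost = proj₂ (proj₁ (proj₂ (Disj-++⁻ pre V.disj)))
  pre∉ : ∀ {x} → x ∈ concat pre → x ∉ α ++ concat post
  pre∉ = proj₂ (proj₂ (Disj-++⁻ pre V.disj))

  βs⊆α : ∀ {x} → x ∈ concat βs → x ∈ α
  βs⊆α x∈ = subst (_ ∈_) joins (∈-join⁺ N βs x∈)

  N∉post : N ∉ concat post
  N∉post = α∉post N∈α
  N∉pre : N ∉ concat pre
  N∉pre N∈ = pre∉ N∈ (∈-++⁺ˡ N∈α)
  N∉βs : N ∉ concat βs
  N∉βs N∈ with ∈-concat⁻′ βs N∈
  ... | β , N∈β , β∈ = All.lookup βs-absent β∈ N∈β

  all⊇ : ∀ {x} → x ∈ concat pre ++ α ++ concat post → x ∈ concat (pre ++ α ∷ post)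
  all⊇ = subst (_ ∈_) (sym (concat-insert pre α post))

  ≤∧∉⇒< : ∀ {x} {w : List ℕ} → x ∈ concat (pre ++ α ∷ post) → x ∈ w → N ∉ w → x < N
  ≤∧∉⇒< x∈ x∈w N∉w = ℕ.≤∧≢⇒< (proj₂ (V.letters x∈)) (λ { refl → N∉w x∈w })

  left< : ∀ {x} → x ∈ concat (pre ++ βs) → x < N
  left< x∈ with ∈-++⁻ (concat pre) (subst (_ ∈_) (concat-++ pre βs) x∈)
  ... | inj₁ x∈pre = ≤∧∉⇒< (all⊇ (∈-++⁺ˡ x∈pre)) x∈pre N∉pre
  ... | inj₂ x∈βs = ≤∧∉⇒< (all⊇ (∈-++⁺ʳ (concat pre) (∈-++⁺ˡ (βs⊆α x∈βs)))) x∈βs N∉βs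

  right< : ∀ {x} → x ∈ concat post → x < N
  right< x∈ = ≤∧∉⇒< (all⊇ (∈-++⁺ʳ (concat pre) (∈-++⁺ʳ α x∈))) x∈ N∉post

  |βs| : length βs ≡ suc r
  |βs| = trans βs-pieces (cong suc (begin
    occ N α                                              ≡⟨ ℕ.+-identityʳ _ ⟨
    occ N α + 0                                          ≡⟨ cong₂ _+_ (refl {x = occ N α}) (occ-∉ (concat post) N∉post) ⟨
    occ N α + occ N (concat post)                        ≡⟨ occ-++ N α (concat post) ⟨
    occ N (α ++ concat post)                             ≡⟨ cong (_+ occ N (α ++ concat post)) (occ-∉ (concat pre) N∉pre) ⟨
    occ N (concat pre) + occ N (α ++ concat post)        ≡⟨ occ-++ N (concat pre) _ ⟨
    occ N (concat pre ++ α ++ concat post)               ≡⟨ cong (occ N) (concat-insert pre α post) ⟨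
    occ N (concat (pre ++ α ∷ post))                     ≡⟨ V.occurrences (ℕ.m<m+n off (s≤s z≤n)) ℕ.≤-refl ⟩
    r                                                    ∎))
    where open ≡-Reasoning

  open Glue N pre βs post (subst (2 ≤_) (sym |βs|) (s≤s 1≤r)) left< right<

  occ-all : ∀ {x} → x ≢ N → occ x (concat (pre ++ α ∷ post)) ≡ occ x (concat (pre ++ βs)) + occ x (concat post)
  occ-all {x} x≢N = trans (cong (λ w → occ x (concat (pre ++ w ∷ post))) (sym joins)) (occ-glue x x≢N)

  Sˡ Sʳ : List ℕ
  Sˡ = S (sortAll (pre ++ βs))
  Sʳ = S (sortAll post)
  -- The size of the left part is read off its sorted word; `range-split` then shows that this word
  -- is the lower interval.
  m : ℕ
  m = length Sˡ

  split : Sˡ ≡ range off m × Sʳ ≡ range (off + m) (length Sʳ) × m + length Sʳ ≡ n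
  split = range-split off n Sˡ Sʳ (proj₁ (List.∷ʳ-injective (Sˡ ++ Sʳ) (range off n) (begin
    (Sˡ ++ Sʳ) ++ [ N ]                           ≡⟨ sort-glue ⟨
    S (sortAll (pre ++ join N βs ∷ post))         ≡⟨ cong (λ w → S (sortAll (pre ++ w ∷ post))) joins ⟩
    S (sortAll (pre ++ α ∷ post))                 ≡⟨ V.sorted ⟩
    range off (suc n)                             ≡⟨ range-snoc off n ⟩
    range off n ++ [ N ]                          ∎)))
    where open ≡-Reasoning

  left-sorted : Sˡ ≡ range off m
  left-sorted = proj₁ split
  right-sorted : Sʳ ≡ range (off + m) (length Sʳ)
  right-sorted = proj₁ (proj₂ split)
  size : m + length Sʳ ≡ n
  size = proj₂ (proj₂ split)

  left-range : ∀ {x} → x ∈ concat (pre ++ βs) → off < x × x ≤ off + m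
  left-range x∈ = ∈-range⁻ (subst (_ ∈_) left-sorted (proj₂ (∈-S (sortAll (pre ++ βs))) (∈-sortAll⁺ (pre ++ βs) x∈)))

  right-range : ∀ {x} → x ∈ concat post → off + m < x × x ≤ off + m + length Sʳ
  right-range x∈ = ∈-range⁻ (subst (_ ∈_) right-sorted (proj₂ (∈-S (sortAll post)) (∈-sortAll⁺ post x∈)))

  x<N : ∀ {x} → x ∈ range off m → x < N
  x<N x∈ = sortAll-left< (proj₁ (∈-S (sortAll (pre ++ βs))) (subst (_ ∈_) (sym left-sorted) x∈))

  right<N : ∀ {x} → x ≤ off + m + length Sʳ → x < N
  right<N {x} x≤ = ℕ.≤-trans (s≤s x≤) (ℕ.≤-reflexive (trans (cong suc (trans (ℕ.+-assoc off m _) (cong (off +_) size))) (sym (ℕ.+-suc off n))))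

  left⊆ : concat (pre ++ βs) ⊆ concat (pre ++ α ∷ post)
  left⊆ = subst₂ _⊆_ (sym (concat-++ pre βs)) (sym (concat-insert pre α post))
    (++⁺ (⊆-refl {x = concat pre}) (++⁺ʳ (concat post) (subst (concat βs ⊆_) joins (concat-⊆-join N βs))))

  right⊆ : concat post ⊆ concat (pre ++ α ∷ post)
  right⊆ = subst (concat post ⊆_) (sym (concat-insert pre α post)) (++⁺ˡ (concat pre) (++⁺ˡ α ⊆-refl))

  dβs : Disj βs
  dβs = Nest-join⇒Disj N βs βs< (λ τ → V.nest (⊆-trans τ
    (subst₂ _⊆_ (sym joins) (sym (concat-insert pre α post)) (++⁺ˡ (concat pre) (++⁺ʳ (concat post) ⊆-refl)))))

-- Enumeration by decomposition

∈-concatMap-intro : ∀ {A B : Set} (f : A → List B) {xs x y} → x ∈ xs → y ∈ f x → y ∈ concatMap f xs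
∈-concatMap-intro f x∈ y∈ = ∈-concatMap⁺ f (lose x∈ y∈)

∈-concatMap-elim : ∀ {A B : Set} (f : A → List B) xs {y} → y ∈ concatMap f xs → ∃[ x ] x ∈ xs × y ∈ f x
∈-concatMap-elim f xs y∈ = find (∈-concatMap⁻ f y∈)

concatMap-unique : ∀ {A B : Set} (f : A → List B) {xs} → Unique xs → (∀ {x} → x ∈ xs → Unique (f x)) →
  (∀ {x y z} → x ∈ xs → y ∈ xs → z ∈ f x → z ∈ f y → x ≡ y) → Unique (concatMap f xs)
concatMap-unique f {[]} _ _ _ = []
concatMap-unique f {x ∷ xs} (x∉ ∷ u) uf apart = Unique.++⁺ (uf (here refl))
  (concatMap-unique f u (uf ∘ there) (λ x∈ y∈ → apart (there x∈) (there y∈)))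
  (λ { (z∈ , z∈′) → let y , y∈ , z∈fy = ∈-concatMap-elim f xs z∈′ in
       All.lookup x∉ y∈ (apart (here refl) (there y∈) z∈ z∈fy) })

∈-indices⁻ : ∀ n {i} → i ∈ indices n → i < n
∈-indices⁻ (suc n) i∈ with ∈-++⁻ (indices n) i∈
... | inj₁ i∈ = ℕ.m≤n⇒m≤1+n (∈-indices⁻ n i∈)
... | inj₂ (here refl) = ℕ.n<1+n n

∈-indices⁺ : ∀ {n i} → i < n → i ∈ indices n
∈-indices⁺ {suc n} {i} (s≤s i≤n) with i ℕ.≟ n
... | yes refl = ∈-++⁺ʳ (indices n) (here refl)
... | no i≢n = ∈-++⁺ˡ (∈-indices⁺ (ℕ.≤∧≢⇒< i≤n i≢n))

indices-unique : ∀ n → Unique (indices n)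
indices-unique zero = []
indices-unique (suc n) = Unique.++⁺ (indices-unique n) ([] ∷ [])
  (λ { (i∈ , here refl) → ℕ.<-irrefl refl (∈-indices⁻ n i∈) })

-- The first i components of A stand before the glued one, and the remaining r + 1 are its blocks;
-- hence the length `r + suc i` of A throughout.
glue : ℕ → ℕ → List (List ℕ) → List (List ℕ) → List (List ℕ)
glue N i A B = take i A ++ join N (drop i A) ∷ B

glues : ℕ → ℕ → List (List (List ℕ)) → List (List (List ℕ)) → List (List (List ℕ))
glues N i As Bs = concatMap (λ A → map (glue N i A) Bs) As

-- All valid tuples of length k on the letters off+1, …, off+n, listed by decomposition at the largest letter;
-- the first argument of enumerate r is fuel, and fuel ≥ n suffices.
enumerate : ℕ → ℕ → ℕ → ℕ → ℕ → List (List (List ℕ))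
enumerate r f off zero k = replicate k [] ∷ []
enumerate r zero off (suc n) k = []
enumerate r (suc f) off (suc n) zero = []
enumerate r (suc f) off (suc n) (suc k) =
  concatMap (λ m → concatMap (λ i →
      glues (off + suc n) i (enumerate r f off m (r + suc i)) (enumerate r f (off + m) (n ∸ m) (k ∸ i)))
    (indices (suc k))) (indices (suc n))

concat-replicate-[] : ∀ k → concat (replicate k ([] {A = ℕ})) ≡ []
concat-replicate-[] zero = refl
concat-replicate-[] (suc k) = concat-replicate-[] k

sortAll-replicate-[] : ∀ k → sortAll (replicate k []) ≡ []
sortAll-replicate-[] zero = refl
sortAll-replicate-[] (suc k) = sortAll-replicate-[] k

Disj-replicate-[] : ∀ k → Disj (replicate k [])
Disj-replicate-[] zero = tt
Disj-replicate-[] (suc k) = (λ ()) , Disj-replicate-[] k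

no-letters : ∀ (αs : List (List ℕ)) → (∀ {x} → x ∉ concat αs) → αs ≡ replicate (length αs) []
no-letters [] _ = refl
no-letters ([] ∷ αs) none = cong ([] ∷_) (no-letters αs none)
no-letters ((a ∷ α) ∷ αs) none = contradiction (here refl) none

empty-valid : ∀ r off k → Valid r off 0 (replicate k [])
empty-valid r off k = record
  { occurrences = λ {x} p q → contradiction (ℕ.≤-trans q (ℕ.≤-reflexive (ℕ.+-identityʳ off))) (ℕ.<⇒≱ p)
  ; nest = nest
  ; disj = Disj-replicate-[] k
  ; sorted = cong S (sortAll-replicate-[] k)
  }
  where
  nest : Nest (concat (replicate k []))
  nest rewrite concat-replicate-[] k = λ ()

valid-empty : ∀ {r off αs} → Valid r off 0 αs → αs ≡ replicate (length αs) []
valid-empty {off = off} {αs} V = no-letters αs (λ x∈ →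
  let p , q = Valid.letters V x∈ in contradiction (ℕ.≤-trans q (ℕ.≤-reflexive (ℕ.+-identityʳ off))) (ℕ.<⇒≱ p))

length-concat-glue : ∀ N pre βs post {r} → length βs ≡ suc r →
  length (concat (pre ++ join N βs ∷ post)) ≡ length (concat (pre ++ βs)) + r + length (concat post)
length-concat-glue N pre (β ∷ βs) post {r} e = begin
  length (concat (pre ++ join N (β ∷ βs) ∷ post))
    ≡⟨ cong length (concat-insert pre (join N (β ∷ βs)) post) ⟩
  length (concat pre ++ join N (β ∷ βs) ++ concat post)
    ≡⟨ cong length (List.++-assoc (concat pre) (join N (β ∷ βs)) (concat post)) ⟨
  length ((concat pre ++ join N (β ∷ βs)) ++ concat post)
    ≡⟨ List.length-++ (concat pre ++ join N (β ∷ βs)) ⟩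
  length (concat pre ++ join N (β ∷ βs)) + length (concat post)
    ≡⟨ cong (_+ length (concat post)) (begin
       length (concat pre ++ join N (β ∷ βs))                       ≡⟨ List.length-++ (concat pre) ⟩
       length (concat pre) + length (join N (β ∷ βs))               ≡⟨ cong (length (concat pre) +_) (trans (length-join N β βs) (cong (length (concat (β ∷ βs)) +_) (ℕ.suc-injective e))) ⟩
       length (concat pre) + (length (concat (β ∷ βs)) + r)         ≡⟨ ℕ.+-assoc (length (concat pre)) _ r ⟨
       length (concat pre) + length (concat (β ∷ βs)) + r           ≡⟨ cong (_+ r) (List.length-++ (concat pre)) ⟨
       length (concat pre ++ concat (β ∷ βs)) + r                   ≡⟨ cong (λ w → length w + r) (concat-++ pre (β ∷ βs)) ⟨
       length (concat (pre ++ β ∷ βs)) + r                          ∎) ⟩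
  length (concat (pre ++ β ∷ βs)) + r + length (concat post) ∎
  where open ≡-Reasoning

i≤r+suc[i] : ∀ r i → i ≤ r + suc i
i≤r+suc[i] r i = ℕ.≤-trans (ℕ.n≤1+n i) (ℕ.m≤n+m (suc i) r)

r+suc[i]∸i : ∀ r i → r + suc i ∸ i ≡ suc r
r+suc[i]∸i r i = trans (cong (_∸ i) (ℕ.+-suc r i)) (ℕ.m+n∸n≡m (suc r) i)

-- `total` is recorded because `p` searches among the tuples of total length r·n.
record Enumerated (r off n k : ℕ) (αs : List (List ℕ)) : Set where
  constructor enumerated
  field
    valid : Valid r off n αs
    components : length αs ≡ k
    total : length (concat αs) ≡ r * n

enumerate-sound : ∀ {r} → 1 ≤ r → ∀ f off n k {αs} → αs ∈ enumerate r f off n k → Enumerated r off n k αs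
enumerate-sound {r} _ f off zero k (here refl) =
  enumerated (empty-valid r off k) (List.length-replicate k) (trans (cong length (concat-replicate-[] k)) (sym (ℕ.*-zeroʳ r)))
enumerate-sound {r} 1≤r (suc f) off (suc n) (suc k) αs∈
  with ∈-concatMap-elim _ (indices (suc n)) αs∈
... | m , m∈ , αs∈ with ∈-concatMap-elim _ (indices (suc k)) αs∈
... | i , i∈ , αs∈ with ∈-concatMap-elim _ (enumerate r f off m (r + suc i)) αs∈
... | A , A∈ , αs∈ with ∈-map⁻ (glue (off + suc n) i A) αs∈
... | B , B∈ , refl = glued (ℕ.≤-pred (∈-indices⁻ (suc n) m∈)) (ℕ.≤-pred (∈-indices⁻ (suc k) i∈))
      (enumerate-sound 1≤r f off m (r + suc i) A∈) (enumerate-sound 1≤r f (off + m) (n ∸ m) (k ∸ i) B∈)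
  where
  glued : m ≤ n → i ≤ k → Enumerated r off m (r + suc i) A → Enumerated r (off + m) (n ∸ m) (k ∸ i) B →
    Enumerated r off (suc n) (suc k) (glue (off + suc n) i A B)
  glued m≤n i≤k (enumerated VA |A| totalA) (enumerated VB |B| totalB) = enumerated
    (subst (λ n → Valid r off (suc n) (glue (off + suc n) i A B)) (ℕ.m+[n∸m]≡n m≤n)
      (compose (take i A) (drop i A) B 1≤r |drop| (subst (Valid r off m) (sym (List.take++drop≡id i A)) VA) VB))
    (begin
      length (take i A ++ join (off + suc n) (drop i A) ∷ B)   ≡⟨ List.length-++ (take i A) ⟩
      length (take i A) + suc (length B)                       ≡⟨ cong₂ (λ a b → a + suc b) |take| |B| ⟩
      i + suc (k ∸ i)                                          ≡⟨ ℕ.+-suc i (k ∸ i) ⟩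
      suc (i + (k ∸ i))                                        ≡⟨ cong suc (ℕ.m+[n∸m]≡n i≤k) ⟩
      suc k                                                    ∎)
    (begin
      length (concat (glue (off + suc n) i A B))                       ≡⟨ length-concat-glue (off + suc n) (take i A) (drop i A) B |drop| ⟩
      length (concat (take i A ++ drop i A)) + r + length (concat B)   ≡⟨ cong (λ A → length (concat A) + r + length (concat B)) (List.take++drop≡id i A) ⟩
      length (concat A) + r + length (concat B)                        ≡⟨ cong₂ (λ a b → a + r + b) totalA totalB ⟩
      r * m + r + r * (n ∸ m)                                          ≡⟨ cong (_+ r * (n ∸ m)) (ℕ.+-comm (r * m) r) ⟩
      r + r * m + r * (n ∸ m)                                          ≡⟨ ℕ.+-assoc r (r * m) (r * (n ∸ m)) ⟩
      r + (r * m + r * (n ∸ m))                                        ≡⟨ cong (r +_) (ℕ.*-distribˡ-+ r m (n ∸ m)) ⟨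
      r + r * (m + (n ∸ m))                                            ≡⟨ cong (λ n → r + r * n) (ℕ.m+[n∸m]≡n m≤n) ⟩
      r + r * n                                                        ≡⟨ ℕ.*-suc r n ⟨
      r * suc n                                                        ∎)
    where
    open ≡-Reasoning
    |take| : length (take i A) ≡ i
    |take| = trans (List.length-take i A) (ℕ.m≤n⇒m⊓n≡m (subst (i ≤_) (sym |A|) (i≤r+suc[i] r i)))
    |drop| : length (drop i A) ≡ suc r
    |drop| = trans (List.length-drop i A) (trans (cong (_∸ i) |A|) (r+suc[i]∸i r i))

take-++-length : ∀ {A : Set} (us vs : List A) → take (length us) (us ++ vs) ≡ us
take-++-length [] vs = refl
take-++-length (u ∷ us) vs = cong (u ∷_) (take-++-length us vs)

drop-++-length : ∀ {A : Set} (us vs : List A) → drop (length us) (us ++ vs) ≡ vs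
drop-++-length [] vs = refl
drop-++-length (u ∷ us) vs = drop-++-length us vs

enumerate-complete : ∀ {r} → 1 ≤ r → ∀ f off n k {αs} → n ≤ f → Valid r off n αs → length αs ≡ k →
  αs ∈ enumerate r f off n k
enumerate-complete _ f off zero k _ V refl = here (valid-empty V)
enumerate-complete {r} 1≤r (suc f) off (suc n) k (s≤s n≤f) V |αs| with decompose 1≤r V
... | record { m = m ; l = l ; pre = pre ; βs = βs ; post = post ; sizes = refl ; glued = refl ; |βs| = |βs| ; left = left ; right = right }
  = member k (trans (sym |αs|) (trans (List.length-++ pre) (ℕ.+-suc (length pre) (length post))))
  where
  N : ℕ
  N = off + suc (m + l)
  -- A fresh `k`, so that the equation for the number of components can be matched with `refl`.
  member : ∀ k → k ≡ suc (length pre + length post) → pre ++ join N βs ∷ post ∈ enumerate r (suc f) off (suc (m + l)) k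
  member .(suc (length pre + length post)) refl =
    ∈-concatMap-intro _ (∈-indices⁺ (s≤s (ℕ.m≤m+n m l)))
      (∈-concatMap-intro _ (∈-indices⁺ (s≤s (ℕ.m≤m+n (length pre) (length post))))
        (∈-concatMap-intro _
          (enumerate-complete 1≤r f off m (r + suc (length pre)) (ℕ.≤-trans (ℕ.m≤m+n m l) n≤f) left
            (trans (List.length-++ pre) (trans (cong (length pre +_) |βs|) (trans (ℕ.+-comm (length pre) (suc r)) (sym (ℕ.+-suc r (length pre)))))))
          (subst (_∈ map (glue N (length pre) (pre ++ βs)) Bs)
            (cong₂ (λ us vs → us ++ join N vs ∷ post) (take-++-length pre βs) (drop-++-length pre βs))
            (∈-map⁺ (glue N (length pre) (pre ++ βs)) post∈))))
    where
    Bs : List (List (List ℕ))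
    Bs = enumerate r f (off + m) (m + l ∸ m) (length pre + length post ∸ length pre)
    post∈ : post ∈ Bs
    post∈ = enumerate-complete 1≤r f (off + m) (m + l ∸ m) _ (ℕ.≤-trans (ℕ.m∸n≤m (m + l) m) n≤f)
      (subst (λ l → Valid r (off + m) l post) (sym (ℕ.m+n∸m≡n m l)) right) (sym (ℕ.m+n∸m≡n (length pre) (length post)))

split-unique : ∀ {N : ℕ} (us : List (List ℕ)) {v vs} us′ {v′ vs′} → us ++ v ∷ vs ≡ us′ ++ v′ ∷ vs′ →
  N ∈ v → N ∈ v′ → N ∉ concat us → N ∉ concat us′ → us ≡ us′ × v ≡ v′ × vs ≡ vs′
split-unique [] [] refl _ _ _ _ = refl , refl , refl
split-unique [] (u ∷ us′) refl N∈ _ _ N∉ = contradiction (∈-++⁺ˡ N∈) N∉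
split-unique (u ∷ us) [] refl _ N∈ N∉ _ = contradiction (∈-++⁺ˡ N∈) N∉
split-unique (u ∷ us) (u′ ∷ us′) e N∈ N∈′ N∉ N∉′ with List.∷-injective e
... | refl , e′ with split-unique us us′ e′ N∈ N∈′ (N∉ ∘ ∈-++⁺ʳ u) (N∉′ ∘ ∈-++⁺ʳ u)
... | refl , p , q = refl , p , q

-- N marks the glued component, which gives back i and B; splitting that component at N gives back
-- its blocks, hence A.
glue-injective : ∀ N r {i i′} {A A′ B B′ : List (List ℕ)} → 1 ≤ r → N ∉ concat A → N ∉ concat A′ →
  length A ≡ r + suc i → length A′ ≡ r + suc i′ → glue N i A B ≡ glue N i′ A′ B′ → i ≡ i′ × A ≡ A′ × B ≡ B′
glue-injective N r {i} {i′} {A} {A′} 1≤r N∉A N∉A′ |A| |A′| e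
  with split-unique (take i A) (take i′ A′) e (N∈ N∉A |A|) (N∈ N∉A′ |A′|) (N∉take i A N∉A) (N∉take i′ A′ N∉A′)
  where
  N∉take : ∀ i (A : List (List ℕ)) → N ∉ concat A → N ∉ concat (take i A)
  N∉take i A N∉ N∈ = N∉ (subst (λ A → N ∈ concat A) (List.take++drop≡id i A)
    (subst (N ∈_) (sym (concat-++ (take i A) (drop i A))) (∈-++⁺ˡ N∈)))
  N∈join : ∀ βs → length βs ≡ suc r → N ∈ join N βs
  N∈join (β ∷ []) e = contradiction 1≤r (λ 1≤r → ℕ.<-irrefl (ℕ.suc-injective e) 1≤r)
  N∈join (β ∷ β′ ∷ βs) _ = ∈-++⁺ʳ β (here refl)
  N∈ : ∀ {i} {A : List (List ℕ)} → N ∉ concat A → length A ≡ r + suc i → N ∈ join N (drop i A)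
  N∈ {i} {A} _ |A| = N∈join (drop i A) (trans (List.length-drop i A) (trans (cong (_∸ i) |A|) (r+suc[i]∸i r i)))
... | takes , joins , refl = i≡i′ , A≡A′ , refl
  where
  |take| : ∀ {i} {A : List (List ℕ)} → length A ≡ r + suc i → length (take i A) ≡ i
  |take| {i} {A} |A| = trans (List.length-take i A) (ℕ.m≤n⇒m⊓n≡m (subst (i ≤_) (sym |A|) (i≤r+suc[i] r i)))
  i≡i′ : i ≡ i′
  i≡i′ = trans (sym (|take| |A|)) (trans (cong length takes) (|take| |A′|))
  splitOn-join-pieces : ∀ βs → length βs ≡ suc r → N ∉ concat βs → splitOn N (join N βs) ≡ βs
  splitOn-join-pieces (β ∷ βs) _ N∉ = splitOn-join N β βs (absent-concat (β ∷ βs) N∉)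
  splitOn-join-drop : ∀ {i} {A : List (List ℕ)} → N ∉ concat A → length A ≡ r + suc i → splitOn N (join N (drop i A)) ≡ drop i A
  splitOn-join-drop {i} {A} N∉ |A| = splitOn-join-pieces (drop i A)
    (trans (List.length-drop i A) (trans (cong (_∸ i) |A|) (r+suc[i]∸i r i)))
    (λ N∈ → N∉ (subst (λ A → N ∈ concat A) (List.take++drop≡id i A)
      (subst (N ∈_) (sym (concat-++ (take i A) (drop i A))) (∈-++⁺ʳ (concat (take i A)) N∈))))
  A≡A′ : A ≡ A′
  A≡A′ = begin
    A                         ≡⟨ List.take++drop≡id i A ⟨
    take i A ++ drop i A      ≡⟨ cong₂ _++_ takes (trans (sym (splitOn-join-drop {i} N∉A |A|)) (trans (cong (splitOn N) joins) (splitOn-join-drop {i′} N∉A′ |A′|))) ⟩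
    take i′ A′ ++ drop i′ A′  ≡⟨ List.take++drop≡id i′ A′ ⟩
    A′                        ∎
    where open ≡-Reasoning

-- Keeps the entries of `enumerate` for different sizes m of the left part apart.
valid-size : ∀ {r off m m′ A} → Valid r off m A → Valid r off m′ A → m ≡ m′
valid-size {off = off} {m} {m′} V V′ = trans (sym (length-range off m))
  (trans (cong length (trans (sym (Valid.sorted V)) (Valid.sorted V′))) (length-range off m′))

enumerate-unique : ∀ {r} → 1 ≤ r → ∀ f off n k → Unique (enumerate r f off n k)
enumerate-unique _ f off zero k = [] ∷ []
enumerate-unique _ zero off (suc n) k = []
enumerate-unique _ (suc f) off (suc n) zero = []
enumerate-unique {r} 1≤r (suc f) off (suc n) (suc k) =
  concatMap-unique _ (indices-unique (suc n))
    (λ {m} m∈ → concatMap-unique _ (indices-unique (suc k))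
      (λ {i} _ → concatMap-unique _ (enumerate-unique 1≤r f off m (r + suc i))
        (λ {A} A∈ → Unique.map⁺ (λ {B} {B′} e → proj₂ (List.∷-injective (List.++-cancelˡ (take i A) _ _ e)))
          (enumerate-unique 1≤r f (off + m) (n ∸ m) (k ∸ i)))
        (λ {A} {A′} A∈ A′∈ z∈ z∈′ →
          let B , _ , e = ∈-map⁻ (glue N i A) z∈ ; B′ , _ , e′ = ∈-map⁻ (glue N i A′) z∈′ in
          proj₁ (proj₂ (same m∈ m∈ A∈ A′∈ (trans (sym e) e′)))))
      (λ {i} {i′} _ _ z∈ z∈′ →
        let A , A∈ , B , e = elim i m z∈ ; A′ , A′∈ , B′ , e′ = elim i′ m z∈′ in
        proj₁ (same m∈ m∈ A∈ A′∈ (trans (sym e) e′))))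
    (λ {m} {m′} m∈ m′∈ z∈ z∈′ →
      let i , _ , z∈ = ∈-concatMap-elim _ (indices (suc k)) z∈
          i′ , _ , z∈′ = ∈-concatMap-elim _ (indices (suc k)) z∈′
          A , A∈ , B , e = elim i m z∈ ; A′ , A′∈ , B′ , e′ = elim i′ m′ z∈′
          A≡A′ = proj₁ (proj₂ (same m∈ m′∈ A∈ A′∈ (trans (sym e) e′))) in
      valid-size (subst (Valid r off m) A≡A′ (Enumerated.valid (sound A∈))) (Enumerated.valid (sound A′∈)))
  where
  N : ℕ
  N = off + suc n
  sound : ∀ {m i A} → A ∈ enumerate r f off m (r + suc i) → Enumerated r off m (r + suc i) A
  sound {m} {i} = enumerate-sound 1≤r f off m (r + suc i)
  elim : ∀ i m {z} → z ∈ glues N i (enumerate r f off m (r + suc i)) (enumerate r f (off + m) (n ∸ m) (k ∸ i)) →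
    ∃[ A ] A ∈ enumerate r f off m (r + suc i) × ∃[ B ] z ≡ glue N i A B
  elim i m z∈ with ∈-concatMap-elim _ (enumerate r f off m (r + suc i)) z∈
  ... | A , A∈ , z∈ with ∈-map⁻ (glue N i A) z∈
  ... | B , _ , e = A , A∈ , B , e
  N∉ : ∀ {m i A} → m ∈ indices (suc n) → A ∈ enumerate r f off m (r + suc i) → N ∉ concat A
  N∉ {m} m∈ A∈ N∈ = ℕ.<⇒≱ (ℕ.+-monoʳ-< off (∈-indices⁻ (suc n) m∈)) (proj₂ (Valid.letters (Enumerated.valid (sound A∈)) N∈))
  same : ∀ {m m′ i i′ A A′ B B′} → m ∈ indices (suc n) → m′ ∈ indices (suc n) →
    A ∈ enumerate r f off m (r + suc i) → A′ ∈ enumerate r f off m′ (r + suc i′) →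
    glue N i A B ≡ glue N i′ A′ B′ → i ≡ i′ × A ≡ A′ × B ≡ B′
  same {m} {m′} m∈ m′∈ A∈ A′∈ = glue-injective N r 1≤r (N∉ m∈ A∈) (N∉ m′∈ A′∈)
    (Enumerated.components (sound {m} A∈)) (Enumerated.components (sound {m′} A′∈))

length-concatMap-cong : ∀ {A B C : Set} (f : A → List B) (g : A → List C) xs →
  (∀ {x} → x ∈ xs → length (f x) ≡ length (g x)) → length (concatMap f xs) ≡ length (concatMap g xs)
length-concatMap-cong f g [] _ = refl
length-concatMap-cong f g (x ∷ xs) e = trans (List.length-++ (f x))
  (trans (cong₂ _+_ (e (here refl)) (length-concatMap-cong f g xs (e ∘ there))) (sym (List.length-++ (g x))))

length-glues : ∀ N i As Bs → length (glues N i As Bs) ≡ length As * length Bs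
length-glues N i [] Bs = refl
length-glues N i (A ∷ As) Bs = trans (List.length-++ (map (glue N i A) Bs))
  (cong₂ _+_ (List.length-map (glue N i A) Bs) (length-glues N i As Bs))

-- The recursion has the same shape at every offset. Thus the right part, although it lives on an
-- upper interval, is counted by the same numbers as tuples on an initial one.
length-enumerate : ∀ r f f′ off off′ n k → n ≤ f → n ≤ f′ →
  length (enumerate r f off n k) ≡ length (enumerate r f′ off′ n k)
length-enumerate r f f′ off off′ zero k _ _ = refl
length-enumerate r (suc f) (suc f′) off off′ (suc n) zero _ _ = refl
length-enumerate r (suc f) (suc f′) off off′ (suc n) (suc k) (s≤s n≤f) (s≤s n≤f′) =
  length-concatMap-cong _ _ (indices (suc n)) (λ {m} m∈ → length-concatMap-cong _ _ (indices (suc k)) (λ {i} _ →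
    let m≤n = ℕ.≤-pred (∈-indices⁻ (suc n) m∈) ; n∸m≤n = ℕ.m∸n≤m n m in
    trans (length-glues (off + suc n) i (enumerate r f off m (r + suc i)) (enumerate r f (off + m) (n ∸ m) (k ∸ i))) (trans
      (cong₂ _*_ (length-enumerate r f f′ off off′ m (r + suc i) (ℕ.≤-trans m≤n n≤f) (ℕ.≤-trans m≤n n≤f′))
                 (length-enumerate r f f′ (off + m) (off′ + m) (n ∸ m) (k ∸ i) (ℕ.≤-trans n∸m≤n n≤f) (ℕ.≤-trans n∸m≤n n≤f′)))
      (sym (length-glues (off′ + suc n) i (enumerate r f′ off′ m (r + suc i)) (enumerate r f′ (off′ + m) (n ∸ m) (k ∸ i)))))))

-- Counting

T⇒true : ∀ {b} → T b → b ≡ true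
T⇒true {true} _ = refl

true⇒T : ∀ {b} → b ≡ true → T b
true⇒T refl = tt

∧-true⁻ : ∀ a {b} → a ∧ b ≡ true → a ≡ true × b ≡ true
∧-true⁻ true e = refl , e

allB⁻ : ∀ {A : Set} (f : A → Bool) xs → allB f xs ≡ true → ∀ {x} → x ∈ xs → f x ≡ true
allB⁻ f (x ∷ xs) e (here refl) = proj₁ (∧-true⁻ (f x) e)
allB⁻ f (x ∷ xs) e (there x∈) = allB⁻ f xs (proj₂ (∧-true⁻ (f x) e)) x∈

allB⁺ : ∀ {A : Set} (f : A → Bool) xs → (∀ {x} → x ∈ xs → f x ≡ true) → allB f xs ≡ true
allB⁺ f [] _ = refl
allB⁺ f (x ∷ xs) h = cong₂ _∧_ (h (here refl)) (allB⁺ f xs (h ∘ there))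

anyB⁻ : ∀ {A : Set} (f : A → Bool) xs → anyB f xs ≡ true → ∃[ x ] x ∈ xs × f x ≡ true
anyB⁻ f (x ∷ xs) e with f x in fx
... | true = x , here refl , fx
... | false = let y , y∈ , fy = anyB⁻ f xs e in y , there y∈ , fy

anyB⁺ : ∀ {A : Set} (f : A → Bool) {xs x} → x ∈ xs → f x ≡ true → anyB f xs ≡ true
anyB⁺ f {x ∷ xs} (here refl) e rewrite e = refl
anyB⁺ f {y ∷ xs} (there x∈) e with f y
... | true = refl
... | false = anyB⁺ f x∈ e

countB-filter : ∀ {A : Set} (f : A → Bool) xs → countB f xs ≡ length (filter (T? ∘ f) xs)
countB-filter f [] = refl
countB-filter f (x ∷ xs) with f x
... | true = cong suc (countB-filter f xs)
... | false = countB-filter f xs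

-- Duplicate-free lists with the same members are permutations of each other. This replaces the
-- exhaustive search in `p` by the length of `enumerate`.
countB-unique : ∀ {A : Set} (f : A → Bool) {xs ys} → Unique xs → Unique ys →
  (∀ {x} → x ∈ xs → f x ≡ true → x ∈ ys) → (∀ {x} → x ∈ ys → x ∈ xs × f x ≡ true) → countB f xs ≡ length ys
countB-unique f {xs} ux uy to from = trans (countB-filter f xs) (↭-length (∼bag⇒↭
  (unique∧set⇒bag (Unique.filter⁺ (T? ∘ f) ux) uy (mk⇔
    (λ x∈ → let x∈xs , fx = ∈-filter⁻ (T? ∘ f) x∈ in to x∈xs (T⇒true fx))
    (λ x∈ → let x∈xs , fx = from x∈ in ∈-filter⁺ (T? ∘ f) x∈xs (true⇒T fx))))))

occursIn : ℕ → List ℕ → Bool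
occursIn a w = anyB (λ b → a ≡ᵇ b) w

occursIn⁻ : ∀ a w → occursIn a w ≡ true → a ∈ w
occursIn⁻ a w e with anyB⁻ (λ b → a ≡ᵇ b) w e
... | b , b∈ , eq = subst (_∈ w) (sym (≡ᵇ-true⇒≡ a b eq)) b∈

occursIn⁺ : ∀ {a w} → a ∈ w → occursIn a w ≡ true
occursIn⁺ {a} a∈ = anyB⁺ (λ b → a ≡ᵇ b) a∈ (≡ᵇ-refl a)

-- The quantity that `isTupleRPerm` bounds by 1; for the letters that occur, this bound is `Disj`.
spread : ℕ → List (List ℕ) → ℕ
spread a αs = countB (occursIn a) αs

spread-∉ : ∀ a αs → a ∉ concat αs → spread a αs ≡ 0
spread-∉ a [] _ = refl
spread-∉ a (α ∷ αs) a∉ with occursIn a α in e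
... | true = contradiction (∈-++⁺ˡ (occursIn⁻ a α e)) a∉
... | false = spread-∉ a αs (a∉ ∘ ∈-++⁺ʳ α)

spread-∈ : ∀ {a} αs → a ∈ concat αs → 0 < spread a αs
spread-∈ {a} (α ∷ αs) a∈ with occursIn a α in e
... | true = s≤s z≤n
... | false with ∈-++⁻ α a∈
... | inj₁ a∈α with () ← trans (sym e) (occursIn⁺ a∈α)
... | inj₂ a∈αs = spread-∈ αs a∈αs

spread-tail : ∀ a α αs → spread a αs ≤ spread a (α ∷ αs)
spread-tail a α αs with occursIn a α
... | true = ℕ.n≤1+n _
... | false = ℕ.≤-refl

spread-Disj : ∀ a αs → Disj αs → spread a αs ≤ 1
spread-Disj a [] _ = z≤n
spread-Disj a (α ∷ αs) (dα , d) with occursIn a α in e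
... | true = s≤s (ℕ.≤-reflexive (spread-∉ a αs (dα (occursIn⁻ a α e))))
... | false = spread-Disj a αs d

Disj-spread : ∀ αs → (∀ {a} → a ∈ concat αs → spread a αs ≤ 1) → Disj αs
Disj-spread [] _ = tt
Disj-spread (α ∷ αs) h =
  (λ {a} a∈α a∈αs → ℕ.<⇒≱ (ℕ.<-≤-trans (s≤s (spread-∈ αs a∈αs)) (twice a∈α)) (h (∈-++⁺ˡ a∈α)))
  , Disj-spread αs (λ {a} a∈ → ℕ.≤-trans (spread-tail a α αs) (h (∈-++⁺ʳ α a∈)))
  where
  twice : ∀ {a} → a ∈ α → suc (spread a αs) ≤ spread a (α ∷ αs)
  twice {a} a∈ rewrite occursIn⁺ a∈ = ℕ.≤-refl

eqList⁻ : ∀ u v → eqList u v ≡ true → u ≡ v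
eqList⁻ [] [] _ = refl
eqList⁻ (a ∷ u) (b ∷ v) e = let p , q = ∧-true⁻ (a ≡ᵇ b) e in cong₂ _∷_ (≡ᵇ-true⇒≡ a b p) (eqList⁻ u v q)

eqList-refl : ∀ u → eqList u u ≡ true
eqList-refl [] = refl
eqList-refl (a ∷ u) = cong₂ _∧_ (≡ᵇ-refl a) (eqList-refl u)

positions₁ : ∀ {a w} → a ∷ [] ⊆ w → ∃[ k ] k < length w × nth w k ≡ a
positions₁ (x ∷ʳ τ) = let k , k< , e = positions₁ τ in suc k , s≤s k< , e
positions₁ (refl ∷ τ) = 0 , s≤s z≤n , refl

positions₂ : ∀ {a b w} → a ∷ b ∷ [] ⊆ w → ∃[ j ] ∃[ k ] j < k × k < length w × nth w j ≡ a × nth w k ≡ b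
positions₂ (x ∷ʳ τ) = let j , k , j<k , k< , e , e′ = positions₂ τ in suc j , suc k , s≤s j<k , s≤s k< , e , e′
positions₂ (refl ∷ τ) = let k , k< , e = positions₁ τ in 0 , suc k , s≤s z≤n , s≤s k< , refl , e

-- Together with `subword₃`, the dictionary between subsequences and the index triples of `isRPerm`.
positions₃ : ∀ {a b c w} → a ∷ b ∷ c ∷ [] ⊆ w →
  ∃[ i ] ∃[ j ] ∃[ k ] i < j × j < k × k < length w × nth w i ≡ a × nth w j ≡ b × nth w k ≡ c
positions₃ (x ∷ʳ τ) = let i , j , k , i<j , j<k , k< , e = positions₃ τ in
  suc i , suc j , suc k , s≤s i<j , s≤s j<k , s≤s k< , e
positions₃ (refl ∷ τ) = let j , k , j<k , k< , e = positions₂ τ in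
  0 , suc j , suc k , s≤s z≤n , s≤s j<k , s≤s k< , refl , e

subword₁ : ∀ w k → k < length w → nth w k ∷ [] ⊆ w
subword₁ (a ∷ w) zero _ = refl ∷ minimum w
subword₁ (a ∷ w) (suc k) (s≤s k<) = a ∷ʳ subword₁ w k k<

subword₂ : ∀ w j k → j < k → k < length w → nth w j ∷ nth w k ∷ [] ⊆ w
subword₂ (a ∷ w) zero (suc k) _ (s≤s k<) = refl ∷ subword₁ w k k<
subword₂ (a ∷ w) (suc j) (suc k) (s≤s j<k) (s≤s k<) = a ∷ʳ subword₂ w j k j<k k<

subword₃ : ∀ w i j k → i < j → j < k → k < length w → nth w i ∷ nth w j ∷ nth w k ∷ [] ⊆ w
subword₃ (a ∷ w) zero (suc j) (suc k) _ (s≤s j<k) (s≤s k<) = refl ∷ subword₂ w j k j<k k<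
subword₃ (a ∷ w) (suc i) (suc j) (suc k) (s≤s i<j) (s≤s j<k) (s≤s k<) = a ∷ʳ subword₃ w i j k i<j j<k k<

-- The innermost condition of `isRPerm`, named so that its three nested `allB` can be opened one at
-- a time.
nestedAt : List ℕ → ℕ → ℕ → ℕ → Bool
nestedAt w i j k = not ((i <ᵇ j) ∧ (j <ᵇ k) ∧ (nth w i ≡ᵇ nth w k)) ∨ (nth w j ≤ᵇ nth w i)

nestB : List ℕ → Bool
nestB w = allB (λ i → allB (λ j → allB (λ k → nestedAt w i j k)
  (indices (length w))) (indices (length w))) (indices (length w))

nestB⁻ : ∀ w → nestB w ≡ true → Nest w
nestB⁻ w e τ with positions₃ τ
... | i , j , k , i<j , j<k , k< , refl , refl , nk≡ni = ℕ.≤ᵇ⇒≤ (nth w j) (nth w i) (true⇒T (trans (sym (premise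
        (T⇒true (ℕ.<⇒<ᵇ i<j)) (T⇒true (ℕ.<⇒<ᵇ j<k)) (T⇒true (ℕ.≡⇒≡ᵇ (nth w i) (nth w k) (sym nk≡ni))))) at))
  where
  I : List ℕ
  I = indices (length w)
  j< : j < length w
  j< = ℕ.<-trans j<k k<
  at : nestedAt w i j k ≡ true
  at = allB⁻ (nestedAt w i j) I (allB⁻ (λ j → allB (nestedAt w i j) I) I
    (allB⁻ (λ i → allB (λ j → allB (nestedAt w i j) I) I) I e (∈-indices⁺ (ℕ.<-trans i<j j<))) (∈-indices⁺ j<)) (∈-indices⁺ k<)
  premise : ∀ {a b c d} → a ≡ true → b ≡ true → c ≡ true → not (a ∧ b ∧ c) ∨ d ≡ d
  premise refl refl refl = refl

nestB⁺ : ∀ w → Nest w → nestB w ≡ true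
nestB⁺ w nest = allB⁺ _ I (λ {i} _ → allB⁺ _ I (λ {j} _ → allB⁺ _ I (λ {k} k∈ → at i j k (∈-indices⁻ (length w) k∈))))
  where
  I : List ℕ
  I = indices (length w)
  at : ∀ i j k → k < length w → nestedAt w i j k ≡ true
  at i j k k< with i <ᵇ j in e₁ | j <ᵇ k in e₂ | nth w i ≡ᵇ nth w k in e₃
  ... | false | _ | _ = refl
  ... | true | false | _ = refl
  ... | true | true | false = refl
  ... | true | true | true = T⇒true (ℕ.≤⇒≤ᵇ (nest (subst (λ c → nth w i ∷ nth w j ∷ c ∷ [] ⊆ w) (sym (≡ᵇ-true⇒≡ _ _ e₃))
          (subword₃ w i j k (ℕ.<ᵇ⇒< i j (true⇒T e₁)) (ℕ.<ᵇ⇒< j k (true⇒T e₂)) k<))))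

counted : ℕ → ℕ → List (List ℕ) → Bool
counted r n αs = isTupleRPerm r n αs ∧ twoStackSortable n αs

counted⇒valid : ∀ r n αs → counted r n αs ≡ true → Valid r 0 n αs
counted⇒valid r n αs e = record
  { occurrences = λ {x} p q → ≡ᵇ-true⇒≡ _ _ (allB⁻ _ (range1 n) occs (subst (x ∈_) (sym (range1≡range n)) (∈-range⁺ p q)))
  ; nest = nestB⁻ (concat αs) nested
  ; disj = Disj-spread αs (λ {a} a∈ → ℕ.≤ᵇ⇒≤ _ 1 (true⇒T (allB⁻ _ (range1 n) single (inRange a∈))))
  ; sorted = trans (eqList⁻ _ _ sortedB) (range1≡range n)
  }
  where
  perm×sorted = ∧-true⁻ (isTupleRPerm r n αs) e
  sortedB = proj₂ perm×sorted
  perm×single = ∧-true⁻ (isRPerm r (range1 n) (concat αs)) (proj₁ perm×sorted)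
  single = proj₂ perm×single
  letters×rest = ∧-true⁻ (allB (λ b → anyB (λ a → a ≡ᵇ b) (range1 n)) (concat αs)) (proj₁ perm×single)
  occs×nested = ∧-true⁻ (allB (λ a → occ a (concat αs) ≡ᵇ r) (range1 n)) (proj₂ letters×rest)
  occs = proj₁ occs×nested
  nested = proj₂ occs×nested
  inRange : ∀ {a} → a ∈ concat αs → a ∈ range1 n
  inRange {a} a∈ with anyB⁻ _ (range1 n) (allB⁻ _ (concat αs) (proj₁ letters×rest) a∈)
  ... | b , b∈ , b≡a = subst (_∈ range1 n) (≡ᵇ-true⇒≡ b a b≡a) b∈

valid-letters : ∀ {r n αs} → Valid r 0 n αs → ∀ {a} → a ∈ concat αs → a ∈ range1 n
valid-letters {n = n} V a∈ = let p , q = Valid.letters V a∈ in subst (_ ∈_) (sym (range1≡range n)) (∈-range⁺ p q)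

valid⇒counted : ∀ {r n αs} → Valid r 0 n αs → counted r n αs ≡ true
valid⇒counted {r} {n} {αs} V = cong₂ _∧_
  (cong₂ _∧_
    (cong₂ _∧_ (allB⁺ _ (concat αs) (λ {b} b∈ → anyB⁺ (λ a → a ≡ᵇ b) (valid-letters V b∈) (≡ᵇ-refl b)))
      (cong₂ _∧_
        (allB⁺ _ (range1 n) (λ {a} a∈ → let p , q = ∈-range⁻ (subst (a ∈_) (range1≡range n) a∈) in
          subst (λ o → (o ≡ᵇ r) ≡ true) (sym (Valid.occurrences V p q)) (≡ᵇ-refl r)))
        (nestB⁺ (concat αs) (Valid.nest V))))
    (allB⁺ _ (range1 n) (λ {a} _ → T⇒true (ℕ.≤⇒≤ᵇ (spread-Disj a αs (Valid.disj V))))))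
  (subst (λ w → eqList (S (sortAll αs)) w ≡ true) (trans (Valid.sorted V) (sym (range1≡range n))) (eqList-refl (S (sortAll αs))))

-- The exhaustive lists of words and tuples

range-unique : ∀ off n → Unique (range off n)
range-unique off zero = []
range-unique off (suc n) = All.tabulate (λ x∈ e → ℕ.<⇒≢ (proj₁ (∈-range⁻ x∈)) e) ∷ range-unique (suc off) n

words-length : ∀ n l {w} → w ∈ words n l → length w ≡ l
words-length n zero (here refl) = refl
words-length n (suc l) w∈ with ∈-concatMap-elim _ (range1 n) w∈
... | a , _ , w∈ with ∈-map⁻ (a ∷_) w∈
... | v , v∈ , refl = cong suc (words-length n l v∈)

words-unique : ∀ n l → Unique (words n l)
words-unique n zero = [] ∷ []
words-unique n (suc l) = concatMap-unique _ (subst Unique (sym (range1≡range n)) (range-unique 0 n))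
  (λ {a} _ → Unique.map⁺ List.∷-injectiveʳ (words-unique n l))
  (λ {a} {b} _ _ z∈ z∈′ → let _ , _ , e = ∈-map⁻ (a ∷_) z∈ ; _ , _ , e′ = ∈-map⁻ (b ∷_) z∈′ in
    List.∷-injectiveˡ (trans (sym e) e′))

words-complete : ∀ n w → (∀ {a} → a ∈ w → a ∈ range1 n) → w ∈ words n (length w)
words-complete n [] _ = here refl
words-complete n (a ∷ w) h = ∈-concatMap-intro _ (h (here refl)) (∈-map⁺ (a ∷_) (words-complete n w (h ∘ there)))

tuples-length : ∀ n k L {αs} → αs ∈ tuples n k L → length αs ≡ k
tuples-length n zero zero (here refl) = refl
tuples-length n (suc k) L αs∈ with ∈-concatMap-elim _ (indices (suc L)) αs∈
... | l , _ , αs∈ with ∈-concatMap-elim _ (words n l) αs∈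
... | α , _ , αs∈ with ∈-map⁻ (α ∷_) αs∈
... | βs , βs∈ , refl = cong suc (tuples-length n k (L ∸ l) βs∈)

tuples-unique : ∀ n k L → Unique (tuples n k L)
tuples-unique n zero zero = [] ∷ []
tuples-unique n zero (suc L) = []
tuples-unique n (suc k) L = concatMap-unique _ (indices-unique (suc L))
  (λ {l} _ → concatMap-unique _ (words-unique n l)
    (λ {α} _ → Unique.map⁺ List.∷-injectiveʳ (tuples-unique n k (L ∸ l)))
    (λ {α} {β} _ _ z∈ z∈′ → let _ , _ , e = ∈-map⁻ (α ∷_) z∈ ; _ , _ , e′ = ∈-map⁻ (β ∷_) z∈′ in
      List.∷-injectiveˡ (trans (sym e) e′)))
  (λ {l} {l′} _ _ z∈ z∈′ →
    let α , α∈ , z∈ = ∈-concatMap-elim _ (words n l) z∈ ; β , β∈ , z∈′ = ∈-concatMap-elim _ (words n l′) z∈′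
        _ , _ , e = ∈-map⁻ (α ∷_) z∈ ; _ , _ , e′ = ∈-map⁻ (β ∷_) z∈′ in
    trans (sym (words-length n l α∈)) (trans (cong length (List.∷-injectiveˡ (trans (sym e) e′))) (words-length n l′ β∈)))

tuples-complete : ∀ n αs → (∀ {a} → a ∈ concat αs → a ∈ range1 n) → αs ∈ tuples n (length αs) (length (concat αs))
tuples-complete n [] _ = here refl
tuples-complete n (α ∷ αs) h = ∈-concatMap-intro _ (∈-indices⁺ (s≤s (ℕ.≤-trans (ℕ.m≤m+n (length α) _) (ℕ.≤-reflexive (sym (List.length-++ α))))))
  (∈-concatMap-intro _ (words-complete n α (h ∘ ∈-++⁺ˡ))
    (∈-map⁺ (α ∷_) (subst (λ L → αs ∈ tuples n (length αs) L)
      (sym (trans (cong (_∸ length α) (List.length-++ α)) (ℕ.m+n∸m≡n (length α) _)))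
      (tuples-complete n αs (h ∘ ∈-++⁺ʳ α)))))

-- Fuel and offset stay arbitrary, so that the lemma applies to both factors of a cell in the
-- recurrence, whatever offset they were enumerated at.
p≡length : ∀ {r} → 1 ≤ r → ∀ f off n k → n ≤ f → p r n k ≡ length (enumerate r f off n k)
p≡length {r} 1≤r f off n k n≤f = trans
  (countB-unique (counted r n) (tuples-unique n k (r * n)) (enumerate-unique 1≤r f 0 n k)
    (λ {αs} αs∈ c → enumerate-complete 1≤r f 0 n k n≤f (counted⇒valid r n αs c) (tuples-length n k (r * n) αs∈))
    (λ {αs} αs∈ → listed αs (enumerate-sound 1≤r f 0 n k αs∈)))
  (length-enumerate r f f 0 off n k n≤f n≤f)
  where
  listed : ∀ αs → Enumerated r 0 n k αs → αs ∈ tuples n k (r * n) × counted r n αs ≡ true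
  listed αs (enumerated V refl total) =
    subst (λ L → αs ∈ tuples n (length αs) L) total (tuples-complete n αs (valid-letters V)) , valid⇒counted V

-- `ℕ→ℚ` reduces its fraction by a gcd that does not compute on variables; unnormalised rationals
-- get around this.
ℕ→ℚ-+ : ∀ m n → ℕ→ℚ (m + n) ≡ ℕ→ℚ m ℚ.+ ℕ→ℚ n
ℕ→ℚ-+ m n = ℚ.toℚᵘ-injective (begin
  toℚᵘ (ℕ→ℚ (m + n))                       ≈⟨ ℚ.toℚᵘ-fromℚᵘ (mkℚᵘ (ℤ.+ (m + n)) 0) ⟩
  mkℚᵘ (ℤ.+ (m + n)) 0                       ≈⟨ *≡* (cong (ℤ._* ℤ.+ 1) (sym (cong₂ ℤ._+_ (ℤ.*-identityʳ (ℤ.+ m)) (ℤ.*-identityʳ (ℤ.+ n))))) ⟩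
  mkℚᵘ (ℤ.+ m) 0 ℚᵘ.+ mkℚᵘ (ℤ.+ n) 0           ≈⟨ ℚᵘ.+-cong (ℚ.toℚᵘ-fromℚᵘ (mkℚᵘ (ℤ.+ m) 0)) (ℚ.toℚᵘ-fromℚᵘ (mkℚᵘ (ℤ.+ n) 0)) ⟨
  toℚᵘ (ℕ→ℚ m) ℚᵘ.+ toℚᵘ (ℕ→ℚ n)           ≈⟨ ℚ.toℚᵘ-homo-+ (ℕ→ℚ m) (ℕ→ℚ n) ⟨
  toℚᵘ (ℕ→ℚ m ℚ.+ ℕ→ℚ n)                   ∎)
  where open ℚᵘ.≃-Reasoning

ℕ→ℚ-* : ∀ m n → ℕ→ℚ (m * n) ≡ ℕ→ℚ m ℚ.* ℕ→ℚ n
ℕ→ℚ-* m n = ℚ.toℚᵘ-injective (begin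
  toℚᵘ (ℕ→ℚ (m * n))                       ≈⟨ ℚ.toℚᵘ-fromℚᵘ (mkℚᵘ (ℤ.+ (m * n)) 0) ⟩
  mkℚᵘ (ℤ.+ (m * n)) 0                       ≈⟨ *≡* (cong (ℤ._* ℤ.+ 1) (ℤ.pos-* m n)) ⟩
  mkℚᵘ (ℤ.+ m) 0 ℚᵘ.* mkℚᵘ (ℤ.+ n) 0           ≈⟨ ℚᵘ.*-cong (ℚ.toℚᵘ-fromℚᵘ (mkℚᵘ (ℤ.+ m) 0)) (ℚ.toℚᵘ-fromℚᵘ (mkℚᵘ (ℤ.+ n) 0)) ⟨
  toℚᵘ (ℕ→ℚ m) ℚᵘ.* toℚᵘ (ℕ→ℚ n)           ≈⟨ ℚ.toℚᵘ-homo-* (ℕ→ℚ m) (ℕ→ℚ n) ⟨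
  toℚᵘ (ℕ→ℚ m ℚ.* ℕ→ℚ n)                   ∎)
  where open ℚᵘ.≃-Reasoning

length-concatMap-indices : ∀ {A : Set} n (f : ℕ → List A) →
  ℕ→ℚ (length (concatMap f (indices (suc n)))) ≡ sumTo n (λ i → ℕ→ℚ (length (f i)))
length-concatMap-indices zero f = cong (ℕ→ℚ ∘ length) (List.++-identityʳ (f 0))
length-concatMap-indices (suc n) f = begin
  ℕ→ℚ (length (concatMap f (indices (suc n) ++ [ suc n ])))
    ≡⟨ cong (ℕ→ℚ ∘ length) (List.concatMap-++ f (indices (suc n)) [ suc n ]) ⟩
  ℕ→ℚ (length (concatMap f (indices (suc n)) ++ (f (suc n) ++ [])))
    ≡⟨ cong (λ w → ℕ→ℚ (length (concatMap f (indices (suc n)) ++ w))) (List.++-identityʳ (f (suc n))) ⟩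
  ℕ→ℚ (length (concatMap f (indices (suc n)) ++ f (suc n)))
    ≡⟨ cong ℕ→ℚ (List.length-++ (concatMap f (indices (suc n)))) ⟩
  ℕ→ℚ (length (concatMap f (indices (suc n))) + length (f (suc n)))
    ≡⟨ ℕ→ℚ-+ (length (concatMap f (indices (suc n)))) (length (f (suc n))) ⟩
  ℕ→ℚ (length (concatMap f (indices (suc n)))) ℚ.+ ℕ→ℚ (length (f (suc n)))
    ≡⟨ cong (ℚ._+ ℕ→ℚ (length (f (suc n)))) (length-concatMap-indices n f) ⟩
  sumTo (suc n) (λ i → ℕ→ℚ (length (f i))) ∎
  where open ≡-Reasoning

Pgf-recurrence : ∀ r → 1 ≤ r → Recurrence r (Pgf r)
Pgf-recurrence r 1≤r = record { initial = λ k → cong ℕ→ℚ (p≡length 1≤r 0 0 0 k z≤n) ; step = step }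
  where
  step : ∀ n k → Pgf r (suc n) k ≡ (shift r (Pgf r) ⊗ Pgf r) n k
  -- Without components there is no place for a letter, in accordance with the zero coefficient of
  -- `shift`.
  step n zero = trans (cong ℕ→ℚ (p≡length 1≤r (suc n) 0 (suc n) 0 ℕ.≤-refl))
    (sym (sumTo-zero n (λ i → ℚ.*-zeroˡ (Pgf r (n ∸ i) 0))))
  step n (suc k) = begin
    ℕ→ℚ (p r (suc n) (suc k))
      ≡⟨ cong ℕ→ℚ (p≡length 1≤r (suc n) 0 (suc n) (suc k) ℕ.≤-refl) ⟩
    ℕ→ℚ (length (concatMap block (indices (suc n))))
      ≡⟨ length-concatMap-indices n block ⟩
    sumTo n (λ m → ℕ→ℚ (length (block m)))
      ≡⟨ sumTo-cong-≤ n (λ m m≤n → begin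
         ℕ→ℚ (length (block m))
           ≡⟨ length-concatMap-indices k (cell m) ⟩
         sumTo k (λ i → ℕ→ℚ (length (cell m i)))
           ≡⟨ sumTo-cong k (λ i → cell-length m m≤n i) ⟩
         sumTo k (λ i → Pgf r m (r + suc i) ℚ.* Pgf r (n ∸ m) (k ∸ i))
           -- Read backwards, this adds the vanishing term at index 0: the number i of components
           -- before N becomes the position j = i + 1.
           ≡⟨ sumTo-tail k (λ j → shift r (Pgf r) m j ℚ.* Pgf r (n ∸ m) (suc k ∸ j)) (ℚ.*-zeroˡ (Pgf r (n ∸ m) (suc k))) ⟨
         sumTo (suc k) (λ j → shift r (Pgf r) m j ℚ.* Pgf r (n ∸ m) (suc k ∸ j)) ∎) ⟩
    (shift r (Pgf r) ⊗ Pgf r) n (suc k) ∎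
    where
    open ≡-Reasoning
    left right : ℕ → ℕ → List (List (List ℕ))
    left m i = enumerate r n 0 m (r + suc i)
    right m i = enumerate r n m (n ∸ m) (k ∸ i)
    cell : ℕ → ℕ → List (List (List ℕ))
    cell m i = glues (suc n) i (left m i) (right m i)
    block : ℕ → List (List (List ℕ))
    block m = concatMap (cell m) (indices (suc k))
    cell-length : ∀ m → m ≤ n → ∀ i → ℕ→ℚ (length (cell m i)) ≡ Pgf r m (r + suc i) ℚ.* Pgf r (n ∸ m) (k ∸ i)
    cell-length m m≤n i = trans (cong ℕ→ℚ (length-glues (suc n) i (left m i) (right m i)))
      (trans (ℕ→ℚ-* (length (left m i)) (length (right m i)))
        (cong₂ (λ a b → ℕ→ℚ a ℚ.* ℕ→ℚ b)
          (sym (p≡length 1≤r n 0 m (r + suc i) m≤n))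
          (sym (p≡length 1≤r n m (n ∸ m) (k ∸ i) (ℕ.m∸n≤m n m)))))

theorem7 : (r : ℕ) → 1 ≤ r →
  -- y : series in x alone, zero constant term, x = y / (1+y)^(2r+1)
  (y : Series) → (∀ n k → y n (suc k) ≡ 0ℚ) → y 0 0 ≡ 0ℚ →
  -- w = 1 / (1+y)^(2r+1)
  (w : Series) → w ⊗ (𝟙 ⊕ y) ^ˢ (2 * r + 1) ≗ˢ 𝟙 →
  X ≗ˢ y ⊗ w →
  -- t = y(1+y) z̄/(1-z̄)
  (t : Series) → t ⊗ (𝟙 ⊖ Z) ≗ˢ y ⊗ (𝟙 ⊕ y) ⊗ Z →
  -- s = √(1 - 4t)  (the square root with constant term 1)
  (s : Series) → s 0 0 ≡ 1ℚ → s ⊗ s ≗ˢ 𝟙 ⊖ ℕ→ℚ 4 ·ˢ t →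
  -- c = c(t) = (1 - s) / (2t)
  (c : Series) → ℕ→ℚ 2 ·ˢ t ⊗ c ≗ˢ 𝟙 ⊖ s →
  -- q = t / (y(1+y))
  (q : Series) → q ⊗ (y ⊗ (𝟙 ⊕ y)) ≗ˢ t →
  -- d = 1 / (1 + y c)^(r+1)
  (d : Series) → d ⊗ (𝟙 ⊕ y ⊗ c) ^ˢ (r + 1) ≗ˢ 𝟙 →
  Pgf r ≗ˢ (𝟙 ⊕ q) ⊗ c ⊗ (𝟙 ⊕ y) ^ˢ (r + 1) ⊗ d
theorem7 r 1≤r y y-free _ w hw hX t ht s _ hs c hc q hq d hd n k =
  trans (recurrence-unique (Pgf-recurrence r 1≤r) P.recurrence n k) (sym (P.closed-form n k))
  where
  module P = ClosedForm r y y-free w hw hX t ht s hs c hc q hq d hd
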